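{- Let $D$ be a simple strongly connected digraph on $n\geq 2$ vertices. Then $2\leq q(D)\leq 2(n-1)$; moreover $q(D)=2n-2$ if and only if $D\cong\overset{\longleftrightarrow}{K_n}$, and $q(D)=2$ if and only if $D\cong\overrightarrow{C_n}$.
   Context: Digraphs are finite and simple (no loops, no multiple arcs; opposite arcs allowed). $q(D)$ is the spectral radius of the signless Laplacian matrix $Q(D)=\mathrm{diag}(d_1^+,\ldots,d_n^+)+A(D)$, where $d_i^+$ is the outdegree of vertex $i$ and $A(D)$ is the adjacency matrix. $\overset{\longleftrightarrow}{K_n}$ is the complete digraph on $n$ vertices (all arcs $(i,j)$, $i\neq j$) and $\overrightarrow{C_n}$ is the directed cycle on $n$ vertices. -}

module Defs where

open import Algebra.Bundles.Raw using (RawMonoid)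
import Algebra.Definitions.RawMonoid as RawMonoidDefs
open import Data.Bool.Base using (Bool; true; false; T; if_then_else_; not; _∧_; _∨_)
open import Data.Fin.Base using (Fin; toℕ)
open import Data.Fin.Properties using () renaming (_≟_ to _≟ᶠ_)
open import Data.Fin.Subset using (∣_∣)
open import Data.Integer.Base using (+_)
open import Data.Nat.Base as ℕ using (ℕ; zero; suc)
import Data.Nat.Properties as ℕₚ
open import Data.Product.Base using (Σ-syntax; _×_; _,_; ∃-syntax)
open import Data.Rational.Base as ℚ using (ℚ; 0ℚ; 1ℚ; ½)
import Data.Rational.Properties as ℚₚ
open import Data.Rational.Solver using (module +-*-Solver)
open import Data.Vec.Base using (tabulate)
open import Data.Vec.Functional using (Vector)
open import Function.Bundles using (_↔_; Inverse)
open import Level using (0ℓ)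
open import Relation.Binary.Construct.Closure.ReflexiveTransitive using (Star)
open import Relation.Binary.PropositionalEquality
  using (_≡_; refl; sym; trans; cong; cong₂; subst)
open import Relation.Nullary.Decidable.Core using (⌊_⌋; yes; no)
open import Relation.Nullary.Negation.Core using (¬_; contradiction)

-- Real numbers as a setoid of Cauchy sequences of rationals.

IsCauchy : (ℕ → ℚ) → Set
IsCauchy x = ∀ ε → 0ℚ ℚ.< ε →
  ∃[ N ] ∀ m n → N ℕ.≤ m → N ℕ.≤ n → ℚ.∣ x m ℚ.- x n ∣ ℚ.≤ ε

record ℝ : Set where
  constructor mkℝ
  field
    seq    : ℕ → ℚ
    cauchy : IsCauchy seq

open ℝ public

infix 4 _≈_ _≤_

_≈_ : ℝ → ℝ → Set
x ≈ y = ∀ ε → 0ℚ ℚ.< ε →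
  ∃[ N ] ∀ n → N ℕ.≤ n → ℚ.∣ seq x n ℚ.- seq y n ∣ ℚ.≤ ε

-- The slack ε makes x ≤ y independent of the representatives.
_≤_ : ℝ → ℝ → Set
x ≤ y = ∀ ε → 0ℚ ℚ.< ε →
  ∃[ N ] ∀ n → N ℕ.≤ n → seq x n ℚ.≤ seq y n ℚ.+ ε

private

  ½-pos : ∀ {ε} → 0ℚ ℚ.< ε → 0ℚ ℚ.< ½ ℚ.* ε
  ½-pos {ε} 0<ε =
    ℚₚ.positive⁻¹ (½ ℚ.* ε) {{ℚₚ.pos*pos⇒pos ½ ε {{ℚ.positive 0<ε}}}}

  ½+½ : ∀ ε → ½ ℚ.* ε ℚ.+ ½ ℚ.* ε ≡ ε
  ½+½ ε = trans (sym (ℚₚ.*-distribʳ-+ ε ½ ½)) (ℚₚ.*-identityˡ ε)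

  module _ where
    open +-*-Solver

    +-rearrange : ∀ a b c d → (a ℚ.+ b) ℚ.- (c ℚ.+ d) ≡ (a ℚ.- c) ℚ.+ (b ℚ.- d)
    +-rearrange = solve 4 (λ a b c d →
      (a :+ b) :+ (:- (c :+ d)) := (a :+ (:- c)) :+ (b :+ (:- d))) refl

    neg-rearrange : ∀ a c → (ℚ.- a) ℚ.- (ℚ.- c) ≡ ℚ.- (a ℚ.- c)
    neg-rearrange = solve 2 (λ a c →
      (:- a) :+ (:- (:- c)) := :- (a :+ (:- c))) refl

    *-rearrange : ∀ a b c d →
      a ℚ.* b ℚ.- c ℚ.* d ≡ a ℚ.* (b ℚ.- d) ℚ.+ d ℚ.* (a ℚ.- c)
    *-rearrange = solve 4 (λ a b c d →
      a :* b :+ (:- (c :* d)) := a :* (b :+ (:- d)) :+ d :* (a :+ (:- c))) refl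

    split : ∀ a c → c ℚ.+ (a ℚ.- c) ≡ a
    split = solve 2 (λ a c → c :+ (a :+ (:- c)) := a) refl

  const-cauchy : ∀ p → IsCauchy (λ _ → p)
  const-cauchy p ε 0<ε = 0 , λ _ _ _ _ →
    subst (λ q → ℚ.∣ q ∣ ℚ.≤ ε) (sym (ℚₚ.+-inverseʳ p)) (ℚₚ.<⇒≤ 0<ε)

  +-cauchy : ∀ x y → IsCauchy x → IsCauchy y → IsCauchy (λ n → x n ℚ.+ y n)
  +-cauchy x y cx cy ε 0<ε
    with cx (½ ℚ.* ε) (½-pos 0<ε) | cy (½ ℚ.* ε) (½-pos 0<ε)
  ... | M , hx | N , hy = M ℕ.⊔ N , λ m n N≤m N≤n → begin
    ℚ.∣ (x m ℚ.+ y m) ℚ.- (x n ℚ.+ y n) ∣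
      ≡⟨ cong ℚ.∣_∣ (+-rearrange (x m) (y m) (x n) (y n)) ⟩
    ℚ.∣ (x m ℚ.- x n) ℚ.+ (y m ℚ.- y n) ∣
      ≤⟨ ℚₚ.∣p+q∣≤∣p∣+∣q∣ (x m ℚ.- x n) (y m ℚ.- y n) ⟩
    ℚ.∣ x m ℚ.- x n ∣ ℚ.+ ℚ.∣ y m ℚ.- y n ∣
      ≤⟨ ℚₚ.+-mono-≤ (hx m n (ℕₚ.m⊔n≤o⇒m≤o M N N≤m) (ℕₚ.m⊔n≤o⇒m≤o M N N≤n))
                     (hy m n (ℕₚ.m⊔n≤o⇒n≤o M N N≤m) (ℕₚ.m⊔n≤o⇒n≤o M N N≤n)) ⟩
    ½ ℚ.* ε ℚ.+ ½ ℚ.* ε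
      ≡⟨ ½+½ ε ⟩
    ε ∎
    where open ℚₚ.≤-Reasoning

  neg-cauchy : ∀ x → IsCauchy x → IsCauchy (λ n → ℚ.- x n)
  neg-cauchy x cx ε 0<ε with cx ε 0<ε
  ... | N , h = N , λ m n N≤m N≤n →
    subst (ℚ._≤ ε)
      (sym (trans (cong ℚ.∣_∣ (neg-rearrange (x m) (x n))) (ℚₚ.∣-p∣≡∣p∣ (x m ℚ.- x n))))
      (h m n N≤m N≤n)

  0<1 : 0ℚ ℚ.< 1ℚ
  0<1 = ℚₚ.positive⁻¹ 1ℚ

  bounded : ∀ x → IsCauchy x →
    ∃[ B ] ℚ.Positive B × ∃[ N ] ∀ n → N ℕ.≤ n → ℚ.∣ x n ∣ ℚ.≤ B
  bounded x cx with cx 1ℚ 0<1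
  ... | N , h = ℚ.∣ x N ∣ ℚ.+ 1ℚ
              , ℚ.positive (ℚₚ.+-mono-≤-< (ℚₚ.0≤∣p∣ (x N)) 0<1)
              , N
              , λ n N≤n → begin
    ℚ.∣ x n ∣                           ≡⟨ cong ℚ.∣_∣ (split (x n) (x N)) ⟨
    ℚ.∣ x N ℚ.+ (x n ℚ.- x N) ∣         ≤⟨ ℚₚ.∣p+q∣≤∣p∣+∣q∣ (x N) (x n ℚ.- x N) ⟩
    ℚ.∣ x N ∣ ℚ.+ ℚ.∣ x n ℚ.- x N ∣     ≤⟨ ℚₚ.+-monoʳ-≤ ℚ.∣ x N ∣ (h n N N≤n ℕₚ.≤-refl) ⟩
    ℚ.∣ x N ∣ ℚ.+ 1ℚ                    ∎
    where open ℚₚ.≤-Reasoning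

  shrink : ∀ B → ℚ.Positive B → ∀ ε → 0ℚ ℚ.< ε →
    ∃[ δ ] 0ℚ ℚ.< δ × B ℚ.* δ ≡ ε
  shrink B B>0 ε 0<ε = 1/B ℚ.* ε
    , ℚₚ.positive⁻¹ (1/B ℚ.* ε)
        {{ℚₚ.pos*pos⇒pos 1/B {{ℚₚ.1/pos⇒pos B {{B>0}}}} ε {{ℚ.positive 0<ε}}}}
    , trans (sym (ℚₚ.*-assoc B 1/B ε))
        (trans (cong (ℚ._* ε) (ℚₚ.*-inverseʳ B {{B≢0}})) (ℚₚ.*-identityˡ ε))
    where
    B≢0 : ℚ.NonZero B
    B≢0 = ℚₚ.pos⇒nonZero B {{B>0}}

    1/B : ℚ
    1/B = (ℚ.1/ B) {{B≢0}}

  ∣*∣≤ : ∀ a d {B δ} → ℚ.Positive B → ℚ.∣ a ∣ ℚ.≤ B → ℚ.∣ d ∣ ℚ.≤ δ →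
    ℚ.∣ a ℚ.* d ∣ ℚ.≤ B ℚ.* δ
  ∣*∣≤ a d {B} {δ} B>0 ∣a∣≤B ∣d∣≤δ = begin
    ℚ.∣ a ℚ.* d ∣       ≡⟨ ℚₚ.∣p*q∣≡∣p∣*∣q∣ a d ⟩
    ℚ.∣ a ∣ ℚ.* ℚ.∣ d ∣
      ≤⟨ ℚₚ.*-monoʳ-≤-nonNeg ℚ.∣ d ∣ {{ℚ.nonNegative (ℚₚ.0≤∣p∣ d)}} ∣a∣≤B ⟩
    B ℚ.* ℚ.∣ d ∣
      ≤⟨ ℚₚ.*-monoˡ-≤-nonNeg B {{ℚₚ.pos⇒nonNeg B {{B>0}}}} ∣d∣≤δ ⟩
    B ℚ.* δ             ∎
    where open ℚₚ.≤-Reasoning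

  *-estimate : ∀ {A B δ η ε} a b c d → ℚ.Positive A → ℚ.Positive B →
    A ℚ.* δ ≡ ½ ℚ.* ε → B ℚ.* η ≡ ½ ℚ.* ε →
    ℚ.∣ a ∣ ℚ.≤ A → ℚ.∣ b ℚ.- d ∣ ℚ.≤ δ → ℚ.∣ d ∣ ℚ.≤ B → ℚ.∣ a ℚ.- c ∣ ℚ.≤ η →
    ℚ.∣ a ℚ.* b ℚ.- c ℚ.* d ∣ ℚ.≤ ε
  *-estimate {A} {B} {δ} {η} {ε} a b c d A>0 B>0 Aδ Bη ∣a∣≤A ∣b-d∣≤δ ∣d∣≤B ∣a-c∣≤η = begin
    ℚ.∣ a ℚ.* b ℚ.- c ℚ.* d ∣
      ≡⟨ cong ℚ.∣_∣ (*-rearrange a b c d) ⟩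
    ℚ.∣ a ℚ.* (b ℚ.- d) ℚ.+ d ℚ.* (a ℚ.- c) ∣
      ≤⟨ ℚₚ.∣p+q∣≤∣p∣+∣q∣ (a ℚ.* (b ℚ.- d)) (d ℚ.* (a ℚ.- c)) ⟩
    ℚ.∣ a ℚ.* (b ℚ.- d) ∣ ℚ.+ ℚ.∣ d ℚ.* (a ℚ.- c) ∣
      ≤⟨ ℚₚ.+-mono-≤ (∣*∣≤ a (b ℚ.- d) A>0 ∣a∣≤A ∣b-d∣≤δ)
                     (∣*∣≤ d (a ℚ.- c) B>0 ∣d∣≤B ∣a-c∣≤η) ⟩
    A ℚ.* δ ℚ.+ B ℚ.* η
      ≡⟨ cong₂ ℚ._+_ Aδ Bη ⟩
    ½ ℚ.* ε ℚ.+ ½ ℚ.* ε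
      ≡⟨ ½+½ ε ⟩
    ε ∎
    where open ℚₚ.≤-Reasoning

  *-cauchy : ∀ x y → IsCauchy x → IsCauchy y → IsCauchy (λ n → x n ℚ.* y n)
  *-cauchy x y cx cy ε 0<ε =
    let A , A>0 , K , bx = bounded x cx
        B , B>0 , L , by = bounded y cy
        δ , 0<δ , Aδ     = shrink A A>0 (½ ℚ.* ε) (½-pos 0<ε)
        η , 0<η , Bη     = shrink B B>0 (½ ℚ.* ε) (½-pos 0<ε)
        M , hy           = cy δ 0<δ
        N , hx           = cx η 0<η
    in *-cauchy′ {x} {y} {K = K} {L} {M} {N} A>0 B>0 Aδ Bη bx by hx hy
    where
    *-cauchy′ : ∀ {x y : ℕ → ℚ} {A B δ η ε K L M N} → ℚ.Positive A → ℚ.Positive B →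
      A ℚ.* δ ≡ ½ ℚ.* ε → B ℚ.* η ≡ ½ ℚ.* ε →
      (∀ n → K ℕ.≤ n → ℚ.∣ x n ∣ ℚ.≤ A) →
      (∀ n → L ℕ.≤ n → ℚ.∣ y n ∣ ℚ.≤ B) →
      (∀ m n → N ℕ.≤ m → N ℕ.≤ n → ℚ.∣ x m ℚ.- x n ∣ ℚ.≤ η) →
      (∀ m n → M ℕ.≤ m → M ℕ.≤ n → ℚ.∣ y m ℚ.- y n ∣ ℚ.≤ δ) →
      ∃[ R ] ∀ m n → R ℕ.≤ m → R ℕ.≤ n → ℚ.∣ x m ℚ.* y m ℚ.- x n ℚ.* y n ∣ ℚ.≤ ε
    *-cauchy′ {x} {y} {K = K} {L} {M} {N} A>0 B>0 Aδ Bη bx by hx hy =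
      (K ℕ.⊔ L) ℕ.⊔ (M ℕ.⊔ N) , λ m n ≤m ≤n →
        *-estimate (x m) (y m) (x n) (y n) A>0 B>0 Aδ Bη
          (bx m (ℕₚ.m⊔n≤o⇒m≤o K L (KL ≤m)))
          (hy m n (ℕₚ.m⊔n≤o⇒m≤o M N (MN ≤m)) (ℕₚ.m⊔n≤o⇒m≤o M N (MN ≤n)))
          (by n (ℕₚ.m⊔n≤o⇒n≤o K L (KL ≤n)))
          (hx m n (ℕₚ.m⊔n≤o⇒n≤o M N (MN ≤m)) (ℕₚ.m⊔n≤o⇒n≤o M N (MN ≤n)))
      where
      KL : ∀ {o} → (K ℕ.⊔ L) ℕ.⊔ (M ℕ.⊔ N) ℕ.≤ o → K ℕ.⊔ L ℕ.≤ o
      KL = ℕₚ.m⊔n≤o⇒m≤o (K ℕ.⊔ L) (M ℕ.⊔ N)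

      MN : ∀ {o} → (K ℕ.⊔ L) ℕ.⊔ (M ℕ.⊔ N) ℕ.≤ o → M ℕ.⊔ N ℕ.≤ o
      MN = ℕₚ.m⊔n≤o⇒n≤o (K ℕ.⊔ L) (M ℕ.⊔ N)

infixl 7 _*_
infixl 6 _+_ _-_
infix  8 -_

_+_ : ℝ → ℝ → ℝ
x + y = mkℝ (λ n → seq x n ℚ.+ seq y n) (+-cauchy (seq x) (seq y) (cauchy x) (cauchy y))

_*_ : ℝ → ℝ → ℝ
x * y = mkℝ (λ n → seq x n ℚ.* seq y n) (*-cauchy (seq x) (seq y) (cauchy x) (cauchy y))

-_ : ℝ → ℝ
- x = mkℝ (λ n → ℚ.- seq x n) (neg-cauchy (seq x) (cauchy x))

_-_ : ℝ → ℝ → ℝ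
x - y = x + (- y)

fromℕ : ℕ → ℝ
fromℕ k = mkℝ (λ _ → + k ℚ./ 1) (const-cauchy (+ k ℚ./ 1))

0ℝ : ℝ
0ℝ = fromℕ 0

infix 4 _≈ᶜ_
infixl 7 _*ᶜ_
infixl 6 _+ᶜ_

record ℂ : Set where
  constructor _+i_
  field
    re im : ℝ

open ℂ public

_≈ᶜ_ : ℂ → ℂ → Set
z ≈ᶜ w = (re z ≈ re w) × (im z ≈ im w)

_+ᶜ_ : ℂ → ℂ → ℂ
z +ᶜ w = (re z + re w) +i (im z + im w)

_*ᶜ_ : ℂ → ℂ → ℂ
z *ᶜ w = (re z * re w - im z * im w) +i (re z * im w + im z * re w)

fromℕᶜ : ℕ → ℂ
fromℕᶜ k = fromℕ k +i 0ℝ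

0ᶜ : ℂ
0ᶜ = fromℕᶜ 0

+ᶜ-rawMonoid : RawMonoid 0ℓ 0ℓ
+ᶜ-rawMonoid = record { Carrier = ℂ ; _≈_ = _≈ᶜ_ ; _∙_ = _+ᶜ_ ; ε = 0ᶜ }

open RawMonoidDefs +ᶜ-rawMonoid public using () renaming (sum to sumᶜ)

-- IsModulus r z says r = |z|: r is the nonnegative square root of
-- (re z)² + (im z)².
IsModulus : ℝ → ℂ → Set
IsModulus r z = (0ℝ ≤ r) × (r * r ≈ re z * re z + im z * im z)

Matrix : Set → ℕ → Set
Matrix A n = Fin n → Fin n → A

_*ᵛ_ : ∀ {n} → Matrix ℂ n → Vector ℂ n → Vector ℂ n
(A *ᵛ v) i = sumᶜ (λ j → A i j *ᶜ v j)

IsEigenvalue : ∀ {n} → Matrix ℂ n → ℂ → Set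
IsEigenvalue {n} A μ = Σ[ v ∈ Vector ℂ n ]
  ¬ (∀ i → v i ≈ᶜ 0ᶜ) × (∀ i → (A *ᵛ v) i ≈ᶜ μ *ᶜ v i)

-- The spectral radius is given by its defining property, which determines
-- it up to _≈_.
IsSpectralRadius : ∀ {n} → Matrix ℂ n → ℝ → Set
IsSpectralRadius A ρ =
  (∃[ μ ] IsEigenvalue A μ × IsModulus ρ μ) ×
  (∀ μ r → IsEigenvalue A μ → IsModulus r μ → r ≤ ρ)

record Digraph (n : ℕ) : Set where
  field
    arc      : Fin n → Fin n → Bool
    loopless : ∀ i → arc i i ≡ false

open Digraph public

Arc : ∀ {n} → Digraph n → Fin n → Fin n → Set
Arc D i j = T (arc D i j)

StronglyConnected : ∀ {n} → Digraph n → Set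
StronglyConnected D = ∀ i j → Star (Arc D) i j

infix 4 _≅_

_≅_ : ∀ {n} → Digraph n → Digraph n → Set
_≅_ {n} D E = Σ[ f ∈ Fin n ↔ Fin n ]
  ∀ i j → arc D i j ≡ arc E (Inverse.to f i) (Inverse.to f j)

outdegree : ∀ {n} → Digraph n → Fin n → ℕ
outdegree D i = ∣ tabulate (arc D i) ∣

diagonal : ∀ {n} → Vector ℕ n → Matrix ℕ n
diagonal d i j = if ⌊ i ≟ᶠ j ⌋ then d i else 0

adjacency : ∀ {n} → Digraph n → Matrix ℕ n
adjacency D i j = if arc D i j then 1 else 0

signlessLaplacian : ∀ {n} → Digraph n → Matrix ℕ n
signlessLaplacian D i j = diagonal (outdegree D) i j ℕ.+ adjacency D i j

IsSignlessLaplacianRadius : ∀ {n} → Digraph n → ℝ → Set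
IsSignlessLaplacianRadius D q = IsSpectralRadius (λ i j → fromℕᶜ (signlessLaplacian D i j)) q

completeDigraph : ∀ n → Digraph n
completeDigraph n = record
  { arc      = λ i j → not ⌊ i ≟ᶠ j ⌋
  ; loopless = irrefl
  }
  where
  irrefl : ∀ i → not ⌊ i ≟ᶠ i ⌋ ≡ false
  irrefl i with i ≟ᶠ i
  ... | yes _  = refl
  ... | no i≢i = contradiction refl i≢i

-- Vertices 0, …, n-1, arcs k → k+1 and n-1 → 0.  For n = 1 the latter would
-- be a loop, hence the bound on n.
directedCycle : ∀ n → 2 ℕ.≤ n → Digraph n
directedCycle n 2≤n = record
  { arc      = λ i j → step (toℕ i) (toℕ j)
  ; loopless = λ i → irrefl (toℕ i)
  }
  where
  step : ℕ → ℕ → Bool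
  step a b = (suc a ℕ.≡ᵇ b) ∨ ((suc a ℕ.≡ᵇ n) ∧ (b ℕ.≡ᵇ 0))

  suc≢ᵇ : ∀ a → (suc a ℕ.≡ᵇ a) ≡ false
  suc≢ᵇ zero    = refl
  suc≢ᵇ (suc a) = suc≢ᵇ a

  1≢ᵇ : ∀ {n} → 2 ℕ.≤ n → ((1 ℕ.≡ᵇ n) ∧ true) ≡ false
  1≢ᵇ (ℕ.s≤s (ℕ.s≤s _)) = refl

  irrefl : ∀ a → step a a ≡ false
  irrefl zero = 1≢ᵇ 2≤n
  irrefl (suc a) rewrite suc≢ᵇ a with suc (suc a) ℕ.≡ᵇ n
  ... | true  = refl
  ... | false = refl

{-# OPTIONS --safe #-}
module Submission where

-- The squared moduli a of an eigenvector satisfy q² aᵢ ≤ rᵢ (Q a)ᵢ, with rᵢ the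
-- i-th row sum, by Cauchy–Schwarz; at an index where a is greatest this gives
-- q ≤ rᵢ, and equality forces all out-neighbours to be greatest as well.  Dually,
-- a positive eigenvector with eigenvalue ρ gives rᵢ ≤ ρ where it is least, with the
-- same propagation in case of equality.  As rᵢ is twice the outdegree and D is
-- strongly connected, equality makes all outdegrees n - 1, respectively 1.
--
-- The positive eigenvector has to be constructed.  Some power S of Qᵀ has a positive
-- row and column, so the enclosures lo · Sᵏ1 ≤ Sᵏz ≤ hi · Sᵏ1 shrink geometrically;
-- the limits of (Sᵏeⱼ)₀ / (Sᵏ1)₀ are the entries of a right eigenvector of Q.
-- Comparisons of reals are ¬¬-stable, so that everything else may be argued
-- classically.

open import Defs
open import Algebra.Bundles using (CommutativeRing)
import Algebra.Properties.CommutativeSemigroup as CommutativeSemigroupProperties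
import Algebra.Properties.Semiring.Sum as SemiringSum
open import Data.Bool.Base using (Bool; true; false; T; if_then_else_)
import Data.Bool.Properties as Boolₚ
open import Data.Fin.Base as Fin using (Fin; toℕ)
import Data.Fin.Properties as Finₚ
open import Data.Fin.Subset using (∣_∣)
open import Data.Integer.Base as ℤ using (+_)
import Data.Integer.Properties as ℤₚ
open import Data.Nat.Base as ℕ using (ℕ; zero; suc)
import Data.Nat.Properties as ℕₚ
open import Data.Product.Base using (Σ-syntax; _×_; _,_; ∃; ∃-syntax; proj₁; proj₂)
open import Data.Rational.Base as ℚ using (ℚ; 0ℚ; 1ℚ; ½)
import Data.Rational.Properties as ℚₚ
open import Data.Rational.Solver using (module +-*-Solver)
import Data.Rational.Unnormalised.Base as ℚᵘ
import Data.Rational.Unnormalised.Properties as ℚᵘₚ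
open import Data.Sum.Base using (_⊎_; inj₁; inj₂; [_,_]′)
open import Data.Vec.Base using (tabulate)
open import Data.Vec.Functional using (Vector)
open import Function.Base using (_∘_; id)
open import Function.Bundles using (_⇔_; mk⇔; _↔_; mk↔ₛ′; Inverse; Equivalence)
open import Function.Construct.Identity using (↔-id)
open import Relation.Binary.Construct.Closure.ReflexiveTransitive as Star using (Star; _◅_)
open import Relation.Binary.PropositionalEquality
  using (_≡_; _≢_; refl; sym; trans; cong; cong₂; subst; module ≡-Reasoning)
open import Relation.Nullary.Decidable.Core using (Dec; yes; no)
open import Relation.Nullary.Negation.Core using (¬_; contradiction)
open SemiringSum (CommutativeRing.semiring ℚₚ.+-*-commutativeRing)
  using (sum; sum-cong-≗; ∑-comm; ∑-distrib-+; *-distribˡ-sum; *-distribʳ-sum; sum-replicate-zero)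
open +-*-Solver using (solve; _:+_; _:*_; _:-_; :-_; _:=_; con)

-- Rational numbers

-- The two bounds on q use different halves of its defining property. That q is the modulus of some
-- eigenvalue yields the upper bound, with whatever complex eigenvector comes along. The other half
-- only says that q dominates the eigenvalues that exist, so for the lower bound one has to be
-- exhibited. Qᵀ is iterated although an eigenvector of Q is wanted, for this reason: φ(z) = lim
-- (Sᵏz)₀ / (Sᵏ1)₀ is a linear functional with φ(1) = 1, and S commutes with Qᵀ, so that φ(Qᵀeᵢ) = ρ
-- φ(eᵢ) for ρ = φ(Qᵀ1). As Qᵀeᵢ is the i-th row of Q, linearity turns the left side into (Qv)ᵢ for
-- vⱼ = φ(eⱼ). The enclosures contract because of vertex 0 alone. At that entry Sᵏz is at least half
-- the gap away from one of its two bounds; this surplus reaches every vertex under S, while every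
-- entry of Sᵏ⁺¹1 is at most a constant multiple of (Sᵏ1)₀. Hence that bound can be moved by a fixed
-- fraction `θ` of the gap.

p-q≥0⇒q≤p : ∀ {p q} → 0ℚ ℚ.≤ p ℚ.- q → q ℚ.≤ p
p-q≥0⇒q≤p {p} {q} 0≤p-q = begin
  q                ≡⟨ ℚₚ.+-identityʳ q ⟨
  q ℚ.+ 0ℚ         ≤⟨ ℚₚ.+-monoʳ-≤ q 0≤p-q ⟩
  q ℚ.+ (p ℚ.- q)  ≡⟨ solve 2 (λ p q → q :+ (p :- q) := p) refl p q ⟩
  p                ∎
  where open ℚₚ.≤-Reasoning

q≤p⇒p-q≥0 : ∀ {p q} → q ℚ.≤ p → 0ℚ ℚ.≤ p ℚ.- q
q≤p⇒p-q≥0 {p} {q} q≤p =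
  subst (ℚ._≤ p ℚ.- q) (ℚₚ.+-inverseʳ q) (ℚₚ.+-monoˡ-≤ (ℚ.- q) q≤p)

-- Turns an inequality into a ring identity for the solver: the difference of the two sides is
-- exhibited as a quantity `r` known to be nonnegative. Most estimates below have this form.
≤-difference : ∀ {p q} r → 0ℚ ℚ.≤ r → p ℚ.- q ≡ r → q ℚ.≤ p
≤-difference r 0≤r eq = p-q≥0⇒q≤p (subst (0ℚ ℚ.≤_) (sym eq) 0≤r)

+-nonneg : ∀ {p q} → 0ℚ ℚ.≤ p → 0ℚ ℚ.≤ q → 0ℚ ℚ.≤ p ℚ.+ q
+-nonneg = ℚₚ.+-mono-≤

*-monoˡ-≤ : ∀ {p q} r → 0ℚ ℚ.≤ r → p ℚ.≤ q → r ℚ.* p ℚ.≤ r ℚ.* q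
*-monoˡ-≤ r 0≤r = ℚₚ.*-monoˡ-≤-nonNeg r {{ℚ.nonNegative 0≤r}}

*-monoʳ-≤ : ∀ {p q} r → 0ℚ ℚ.≤ r → p ℚ.≤ q → p ℚ.* r ℚ.≤ q ℚ.* r
*-monoʳ-≤ r 0≤r = ℚₚ.*-monoʳ-≤-nonNeg r {{ℚ.nonNegative 0≤r}}

*-nonneg : ∀ {p q} → 0ℚ ℚ.≤ p → 0ℚ ℚ.≤ q → 0ℚ ℚ.≤ p ℚ.* q
*-nonneg {p} {q} 0≤p 0≤q = subst (ℚ._≤ p ℚ.* q) (ℚₚ.*-zeroʳ p) (*-monoˡ-≤ p 0≤p 0≤q)

*-positive : ∀ {p q} → 0ℚ ℚ.< p → 0ℚ ℚ.< q → 0ℚ ℚ.< p ℚ.* q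
*-positive {p} {q} 0<p 0<q =
  ℚₚ.positive⁻¹ _ {{ℚₚ.pos*pos⇒pos p {{ℚ.positive 0<p}} q {{ℚ.positive 0<q}}}}

square-nonneg : ∀ p → 0ℚ ℚ.≤ p ℚ.* p
square-nonneg p with ℚₚ.≤-total 0ℚ p
... | inj₁ 0≤p = *-nonneg 0≤p 0≤p
... | inj₂ p≤0 = subst (0ℚ ℚ.≤_) (solve 1 (λ p → (:- p) :* (:- p) := p :* p) refl p)
                   (*-nonneg (ℚₚ.neg-antimono-≤ p≤0) (ℚₚ.neg-antimono-≤ p≤0))

0<1ℚ : 0ℚ ℚ.< 1ℚ
0<1ℚ = ℚₚ.positive⁻¹ 1ℚ

half-positive : ∀ {p} → 0ℚ ℚ.< p → 0ℚ ℚ.< ½ ℚ.* p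
half-positive = *-positive (ℚₚ.positive⁻¹ ½)

half+half : ∀ p → ½ ℚ.* p ℚ.+ ½ ℚ.* p ≡ p
half+half p = trans (sym (ℚₚ.*-distribʳ-+ p ½ ½)) (ℚₚ.*-identityˡ p)

divide-positive : ∀ {p} → 0ℚ ℚ.< p → ∀ {q} → 0ℚ ℚ.< q → ∃[ r ] 0ℚ ℚ.< r × p ℚ.* r ≡ q
divide-positive {p} 0<p {q} 0<q = p⁻¹ ℚ.* q
  , *-positive (ℚₚ.positive⁻¹ p⁻¹ {{ℚₚ.1/pos⇒pos p {{ℚ.positive 0<p}}}}) 0<q
  , trans (sym (ℚₚ.*-assoc p p⁻¹ q))
      (trans (cong (ℚ._* q) (ℚₚ.*-inverseʳ p {{ℚ.>-nonZero 0<p}})) (ℚₚ.*-identityˡ q))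
  where
  p⁻¹ : ℚ
  p⁻¹ = (ℚ.1/ p) {{ℚ.>-nonZero 0<p}}

∣p∣≤q : ∀ {p q} → p ℚ.≤ q → ℚ.- q ℚ.≤ p → ℚ.∣ p ∣ ℚ.≤ q
∣p∣≤q {p} {q} p≤q -q≤p with ℚₚ.≤-total 0ℚ p
... | inj₁ 0≤p = subst (ℚ._≤ q) (sym (ℚₚ.0≤p⇒∣p∣≡p 0≤p)) p≤q
... | inj₂ p≤0 = begin
  ℚ.∣ p ∣      ≡⟨ ℚₚ.∣-p∣≡∣p∣ p ⟨
  ℚ.∣ ℚ.- p ∣  ≡⟨ ℚₚ.0≤p⇒∣p∣≡p (ℚₚ.neg-antimono-≤ p≤0) ⟩
  ℚ.- p        ≤⟨ ℚₚ.neg-antimono-≤ -q≤p ⟩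
  ℚ.- ℚ.- q    ≡⟨ solve 1 (λ q → :- (:- q) := q) refl q ⟩
  q            ∎
  where open ℚₚ.≤-Reasoning

p≤∣p∣ : ∀ p → p ℚ.≤ ℚ.∣ p ∣
p≤∣p∣ p with ℚₚ.≤-total 0ℚ p
... | inj₁ 0≤p = ℚₚ.≤-reflexive (sym (ℚₚ.0≤p⇒∣p∣≡p 0≤p))
... | inj₂ p≤0 = ℚₚ.≤-trans p≤0 (ℚₚ.0≤∣p∣ p)

∣p-q∣≡∣q-p∣ : ∀ p q → ℚ.∣ p ℚ.- q ∣ ≡ ℚ.∣ q ℚ.- p ∣
∣p-q∣≡∣q-p∣ p q = trans (cong ℚ.∣_∣ (solve 2 (λ p q → p :- q := :- (q :- p)) refl p q))
  (ℚₚ.∣-p∣≡∣p∣ (q ℚ.- p))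

∣p-q∣≤r⇒p≤q+r : ∀ p q {r} → ℚ.∣ p ℚ.- q ∣ ℚ.≤ r → p ℚ.≤ q ℚ.+ r
∣p-q∣≤r⇒p≤q+r p q {r} h = begin
  p                ≡⟨ solve 2 (λ p q → q :+ (p :- q) := p) refl p q ⟨
  q ℚ.+ (p ℚ.- q)  ≤⟨ ℚₚ.+-monoʳ-≤ q (ℚₚ.≤-trans (p≤∣p∣ (p ℚ.- q)) h) ⟩
  q ℚ.+ r          ∎
  where open ℚₚ.≤-Reasoning

∣p-q∣≤r : ∀ p q {r} → p ℚ.≤ q ℚ.+ r → q ℚ.≤ p ℚ.+ r → ℚ.∣ p ℚ.- q ∣ ℚ.≤ r
∣p-q∣≤r p q {r} p≤q+r q≤p+r = ∣p∣≤q
  (≤-difference _ (q≤p⇒p-q≥0 p≤q+r) (solve 3 (λ p q r → r :- (p :- q) := (q :+ r) :- p) refl p q r))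
  (≤-difference _ (q≤p⇒p-q≥0 q≤p+r) (solve 3 (λ p q r → (p :- q) :- (:- r) := (p :+ r) :- q) refl p q r))

-- The entries of `fromℕ k` are `ι k` by definition, so facts about `ι` transfer to `fromℕ` without
-- conversion.
ι : ℕ → ℚ
ι k = + k ℚ./ 1

ι-homo-+ : ∀ a b → ι (a ℕ.+ b) ≡ ι a ℚ.+ ι b
ι-homo-+ a b = ℚₚ.toℚᵘ-injective (begin
  ℚ.toℚᵘ (ι (a ℕ.+ b))                ≈⟨ ℚₚ.toℚᵘ-fromℚᵘ (ℚᵘ.mkℚᵘ (+ (a ℕ.+ b)) 0) ⟩
  ℚᵘ.mkℚᵘ (+ (a ℕ.+ b)) 0             ≈⟨ ℚᵘ.*≡* (cong (ℤ._* + 1) numerators) ⟩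
  ℚᵘ.mkℚᵘ (+ a) 0 ℚᵘ.+ ℚᵘ.mkℚᵘ (+ b) 0
    ≈⟨ ℚᵘₚ.+-cong (ℚₚ.toℚᵘ-fromℚᵘ (ℚᵘ.mkℚᵘ (+ a) 0)) (ℚₚ.toℚᵘ-fromℚᵘ (ℚᵘ.mkℚᵘ (+ b) 0)) ⟨
  ℚ.toℚᵘ (ι a) ℚᵘ.+ ℚ.toℚᵘ (ι b)      ≈⟨ ℚₚ.toℚᵘ-homo-+ (ι a) (ι b) ⟨
  ℚ.toℚᵘ (ι a ℚ.+ ι b)                ∎)
  where
  open ℚᵘₚ.≃-Reasoning
  numerators : + (a ℕ.+ b) ≡ + a ℤ.* + 1 ℤ.+ + b ℤ.* + 1
  numerators = trans (ℤₚ.pos-+ a b)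
    (sym (cong₂ ℤ._+_ (ℤₚ.*-identityʳ (+ a)) (ℤₚ.*-identityʳ (+ b))))

ι-nonneg : ∀ k → 0ℚ ℚ.≤ ι k
ι-nonneg k = ℚₚ.nonNegative⁻¹ (ι k) {{ℚₚ.normalize-nonNeg k 1}}

ι-mono-≤ : ∀ {a b} → a ℕ.≤ b → ι a ℚ.≤ ι b
ι-mono-≤ {a} {b} a≤b = begin
  ι a                      ≡⟨ ℚₚ.+-identityʳ (ι a) ⟨
  ι a ℚ.+ 0ℚ               ≤⟨ ℚₚ.+-monoʳ-≤ (ι a) (ι-nonneg (b ℕ.∸ a)) ⟩
  ι a ℚ.+ ι (b ℕ.∸ a)      ≡⟨ ι-homo-+ a (b ℕ.∸ a) ⟨
  ι (a ℕ.+ (b ℕ.∸ a))      ≡⟨ cong ι (ℕₚ.m+[n∸m]≡n a≤b) ⟩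
  ι b                      ∎
  where open ℚₚ.≤-Reasoning

ι-suc : ∀ k → ι (suc k) ≡ 1ℚ ℚ.+ ι k
ι-suc = ι-homo-+ 1

ι-positive : ∀ {k} → 1 ℕ.≤ k → 0ℚ ℚ.< ι k
ι-positive 1≤k = ℚₚ.<-≤-trans 0<1ℚ (ι-mono-≤ 1≤k)

-- Finite sums and the weighted Cauchy-Schwarz inequality

sumℕ : ∀ {n} → Vector ℕ n → ℕ
sumℕ {zero}  f = 0
sumℕ {suc n} f = f Fin.zero ℕ.+ sumℕ (f ∘ Fin.suc)

sum-ι : ∀ {n} (f : Vector ℕ n) → sum (λ i → ι (f i)) ≡ ι (sumℕ f)
sum-ι {zero}  f = refl
sum-ι {suc n} f = trans (cong (ι (f Fin.zero) ℚ.+_) (sum-ι (f ∘ Fin.suc)))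
  (sym (ι-homo-+ (f Fin.zero) (sumℕ (f ∘ Fin.suc))))

sum-mono-≤ : ∀ {n} {f g : Vector ℚ n} → (∀ i → f i ℚ.≤ g i) → sum f ℚ.≤ sum g
sum-mono-≤ {zero}  f≤g = ℚₚ.≤-refl
sum-mono-≤ {suc n} f≤g = ℚₚ.+-mono-≤ (f≤g Fin.zero) (sum-mono-≤ (f≤g ∘ Fin.suc))

sum-nonneg : ∀ {n} {f : Vector ℚ n} → (∀ i → 0ℚ ℚ.≤ f i) → 0ℚ ℚ.≤ sum f
sum-nonneg {n} {f} 0≤f = subst (ℚ._≤ sum f) (sum-replicate-zero n) (sum-mono-≤ 0≤f)

term≤sum : ∀ {n} {f : Vector ℚ n} → (∀ i → 0ℚ ℚ.≤ f i) → ∀ k → f k ℚ.≤ sum f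
term≤sum {suc n} {f} 0≤f Fin.zero = begin
  f Fin.zero                               ≡⟨ ℚₚ.+-identityʳ (f Fin.zero) ⟨
  f Fin.zero ℚ.+ 0ℚ                        ≤⟨ ℚₚ.+-monoʳ-≤ (f Fin.zero) (sum-nonneg (0≤f ∘ Fin.suc)) ⟩
  f Fin.zero ℚ.+ sum (λ i → f (Fin.suc i)) ∎
  where open ℚₚ.≤-Reasoning
term≤sum {suc n} {f} 0≤f (Fin.suc k) = begin
  f (Fin.suc k)                            ≤⟨ term≤sum (0≤f ∘ Fin.suc) k ⟩
  sum (λ i → f (Fin.suc i))                ≡⟨ ℚₚ.+-identityˡ _ ⟨
  0ℚ ℚ.+ sum (λ i → f (Fin.suc i))         ≤⟨ ℚₚ.+-monoˡ-≤ _ (0≤f Fin.zero) ⟩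
  f Fin.zero ℚ.+ sum (λ i → f (Fin.suc i)) ∎
  where open ℚₚ.≤-Reasoning

-- Used with s = Σ wᵢ and t = Σ wᵢxᵢ. These sums change along the induction, so `s` and `t` have to
-- be arbitrary.
weighted-squares : ∀ {n} (w x : Vector ℚ n) s t →
  sum (λ i → w i ℚ.* ((s ℚ.* x i ℚ.- t) ℚ.* (s ℚ.* x i ℚ.- t))) ≡
  s ℚ.* s ℚ.* sum (λ i → w i ℚ.* (x i ℚ.* x i))
    ℚ.- (s ℚ.* t ℚ.+ s ℚ.* t) ℚ.* sum (λ i → w i ℚ.* x i) ℚ.+ t ℚ.* t ℚ.* sum w
weighted-squares {zero} w x s t =
  solve 2 (λ s t → con 0ℚ := s :* s :* con 0ℚ :- (s :* t :+ s :* t) :* con 0ℚ :+ t :* t :* con 0ℚ)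
    refl s t
weighted-squares {suc n} w x s t =
  trans (cong (w Fin.zero ℚ.* ((s ℚ.* x Fin.zero ℚ.- t) ℚ.* (s ℚ.* x Fin.zero ℚ.- t)) ℚ.+_)
          (weighted-squares (w ∘ Fin.suc) (x ∘ Fin.suc) s t))
    (solve 7 (λ w x s t B A W →
      w :* ((s :* x :- t) :* (s :* x :- t)) :+ (s :* s :* B :- (s :* t :+ s :* t) :* A :+ t :* t :* W)
      := s :* s :* (w :* (x :* x) :+ B) :- (s :* t :+ s :* t) :* (w :* x :+ A) :+ t :* t :* (w :+ W))
      refl (w Fin.zero) (x Fin.zero) s t _ _ _)

-- The nonnegative sum Σ wᵢ(W xᵢ - A)² equals W (W B - A²), and the positive `W` cancels. Scaling
-- `x` by `W` avoids dividing by it to form the mean A / W.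
weighted-cauchy-schwarz : ∀ {n} (w x : Vector ℚ n) → (∀ i → 0ℚ ℚ.≤ w i) → 0ℚ ℚ.< sum w →
  sum (λ i → w i ℚ.* x i) ℚ.* sum (λ i → w i ℚ.* x i) ℚ.≤
  sum w ℚ.* sum (λ i → w i ℚ.* (x i ℚ.* x i))
weighted-cauchy-schwarz w x 0≤w 0<W =
  ℚₚ.*-cancelˡ-≤-pos W {{ℚ.positive 0<W}} (≤-difference _
    (sum-nonneg (λ i → *-nonneg (0≤w i) (square-nonneg (W ℚ.* x i ℚ.- A))))
    (sym (trans (weighted-squares w x W A)
      (solve 3 (λ W A B → W :* W :* B :- (W :* A :+ W :* A) :* A :+ A :* A :* W
                          := W :* (W :* B) :- W :* (A :* A)) refl W A B))))
  where
  W A B : ℚ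
  W = sum w
  A = sum (λ i → w i ℚ.* x i)
  B = sum (λ i → w i ℚ.* (x i ℚ.* x i))

-- `δ j` is the unit vector eⱼ. The recursion on both indices makes `sum-δ` and `δ-sym` structural
-- inductions.
δ : ∀ {n} → Fin n → Fin n → ℚ
δ Fin.zero    Fin.zero    = 1ℚ
δ Fin.zero    (Fin.suc j) = 0ℚ
δ (Fin.suc i) Fin.zero    = 0ℚ
δ (Fin.suc i) (Fin.suc j) = δ i j

δ-nonneg : ∀ {n} (i j : Fin n) → 0ℚ ℚ.≤ δ i j
δ-nonneg Fin.zero    Fin.zero    = ℚₚ.<⇒≤ 0<1ℚ
δ-nonneg Fin.zero    (Fin.suc j) = ℚₚ.≤-refl
δ-nonneg (Fin.suc i) Fin.zero    = ℚₚ.≤-refl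
δ-nonneg (Fin.suc i) (Fin.suc j) = δ-nonneg i j

sum-zero : ∀ {n} {f : Vector ℚ n} → (∀ i → f i ≡ 0ℚ) → sum f ≡ 0ℚ
sum-zero {n} f≡0 = trans (sum-cong-≗ f≡0) (sum-replicate-zero n)

sum-δ : ∀ {n} (i : Fin n) (f : Vector ℚ n) → sum (λ j → δ j i ℚ.* f j) ≡ f i
sum-δ Fin.zero f = trans
  (cong₂ ℚ._+_ (ℚₚ.*-identityˡ (f Fin.zero)) (sum-zero (λ j → ℚₚ.*-zeroˡ (f (Fin.suc j)))))
  (ℚₚ.+-identityʳ (f Fin.zero))
sum-δ (Fin.suc i) f = trans
  (cong₂ ℚ._+_ (ℚₚ.*-zeroˡ (f Fin.zero)) (sum-δ i (f ∘ Fin.suc)))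
  (ℚₚ.+-identityˡ (f (Fin.suc i)))

ℚ-<⇒≱ : ∀ {p q} → p ℚ.< q → ¬ q ℚ.≤ p
ℚ-<⇒≱ p<q q≤p = ℚₚ.<-irrefl refl (ℚₚ.<-≤-trans p<q q≤p)

-- Real numbers

Eventually : (ℕ → Set) → Set
Eventually P = ∃[ N ] ∀ n → N ℕ.≤ n → P n

always : ∀ {P : ℕ → Set} → (∀ n → P n) → Eventually P
always p = 0 , λ n _ → p n

eventually-map : ∀ {P Q : ℕ → Set} → (∀ n → P n → Q n) → Eventually P → Eventually Q
eventually-map f (N , p) = N , λ n N≤n → f n (p n N≤n)

eventually-zip : ∀ {P Q R : ℕ → Set} → (∀ n → P n → Q n → R n) →
  Eventually P → Eventually Q → Eventually R
eventually-zip f (M , p) (N , q) = M ℕ.⊔ N , λ n h →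
  f n (p n (ℕₚ.m⊔n≤o⇒m≤o M N h)) (q n (ℕₚ.m⊔n≤o⇒n≤o M N h))

eventually-absurd : ∀ {P : ℕ → Set} → (∀ n → ¬ P n) → ¬ Eventually P
eventually-absurd ¬p (N , p) = ¬p N (p N ℕₚ.≤-refl)

infix 4 _<_

_<_ : ℝ → ℝ → Set
x < y = ∃[ η ] 0ℚ ℚ.< η × Eventually (λ n → seq x n ℚ.+ η ℚ.≤ seq y n)

pointwise-≈ : ∀ {x y} → (∀ n → seq x n ≡ seq y n) → x ≈ y
pointwise-≈ {x} {y} eq ε 0<ε = always λ n → subst (ℚ._≤ ε)
  (sym (cong ℚ.∣_∣ (trans (cong (ℚ._- seq y n) (eq n)) (ℚₚ.+-inverseʳ (seq y n)))))
  (ℚₚ.<⇒≤ 0<ε)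

≤-weaken : ∀ {p q r} → 0ℚ ℚ.≤ r → p ℚ.≤ q → p ℚ.≤ q ℚ.+ r
≤-weaken {p} {q} {r} 0≤r p≤q =
  subst (ℚ._≤ q ℚ.+ r) (ℚₚ.+-identityʳ p) (ℚₚ.+-mono-≤ p≤q 0≤r)

pointwise-≤ : ∀ {x y} → (∀ n → seq x n ℚ.≤ seq y n) → x ≤ y
pointwise-≤ x≤y ε 0<ε = always λ n → ≤-weaken (ℚₚ.<⇒≤ 0<ε) (x≤y n)

≈-sym : ∀ {x y} → x ≈ y → y ≈ x
≈-sym {x} {y} x≈y ε 0<ε = eventually-map
  (λ n → subst (ℚ._≤ ε) (∣p-q∣≡∣q-p∣ (seq x n) (seq y n))) (x≈y ε 0<ε)

≈⇒≤ : ∀ {x y} → x ≈ y → x ≤ y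
≈⇒≤ {x} {y} x≈y ε 0<ε = eventually-map
  (λ n → ∣p-q∣≤r⇒p≤q+r (seq x n) (seq y n)) (x≈y ε 0<ε)

≈⇒≥ : ∀ {x y} → x ≈ y → y ≤ x
≈⇒≥ {x} {y} x≈y = ≈⇒≤ {y} {x} (≈-sym {x} {y} x≈y)

≤-antisym : ∀ {x y} → x ≤ y → y ≤ x → x ≈ y
≤-antisym {x} {y} x≤y y≤x ε 0<ε = eventually-zip
  (λ n → ∣p-q∣≤r (seq x n) (seq y n)) (x≤y ε 0<ε) (y≤x ε 0<ε)

≤-refl : ∀ {x} → x ≤ x
≤-refl {x} = pointwise-≤ {x} {x} (λ _ → ℚₚ.≤-refl)

≤-trans : ∀ {x y z} → x ≤ y → y ≤ z → x ≤ z
≤-trans {x} {y} {z} x≤y y≤z ε 0<ε = eventually-zip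
  (λ n p q → ≤-difference _ (+-nonneg (q≤p⇒p-q≥0 p) (q≤p⇒p-q≥0 q))
    (solve 4 (λ x y z ε → (z :+ ε) :- x :=
        (y :+ con ½ :* ε :- x) :+ (z :+ con ½ :* ε :- y))
      refl (seq x n) (seq y n) (seq z n) ε))
  (x≤y (½ ℚ.* ε) (half-positive 0<ε)) (y≤z (½ ℚ.* ε) (half-positive 0<ε))

≈-trans : ∀ {x y z} → x ≈ y → y ≈ z → x ≈ z
≈-trans {x} {y} {z} x≈y y≈z = ≤-antisym {x} {z}
  (≤-trans {x} {y} {z} (≈⇒≤ {x} {y} x≈y) (≈⇒≤ {y} {z} y≈z))
  (≤-trans {z} {y} {x} (≈⇒≥ {y} {z} y≈z) (≈⇒≥ {x} {y} x≈y))

+-mono-≤ : ∀ {x y u v} → x ≤ y → u ≤ v → x + u ≤ y + v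
+-mono-≤ {x} {y} {u} {v} x≤y u≤v ε 0<ε = eventually-zip
  (λ n p q → ≤-difference _ (+-nonneg (q≤p⇒p-q≥0 p) (q≤p⇒p-q≥0 q))
    (solve 5 (λ x y u v ε → (y :+ v :+ ε) :- (x :+ u) :=
        (y :+ con ½ :* ε :- x) :+ (v :+ con ½ :* ε :- u))
      refl (seq x n) (seq y n) (seq u n) (seq v n) ε))
  (x≤y (½ ℚ.* ε) (half-positive 0<ε)) (u≤v (½ ℚ.* ε) (half-positive 0<ε))

+-cong : ∀ {x y u v} → x ≈ y → u ≈ v → x + u ≈ y + v
+-cong {x} {y} {u} {v} x≈y u≈v = ≤-antisym {x + u} {y + v}
  (+-mono-≤ {x} {y} {u} {v} (≈⇒≤ {x} {y} x≈y) (≈⇒≤ {u} {v} u≈v))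
  (+-mono-≤ {y} {x} {v} {u} (≈⇒≥ {x} {y} x≈y) (≈⇒≥ {u} {v} u≈v))

-- One rational comparison decides: the entries at a late index `k` are compared at threshold ε/2,
-- and each sequence stays within ε/8 of its entry there. A positive answer leaves ε/4 to spare; a
-- negative one gives the gap ε/4.
≤-slack-or-> : ∀ x y ε → 0ℚ ℚ.< ε →
  Eventually (λ n → seq x n ℚ.≤ seq y n ℚ.+ ε) ⊎ y < x
≤-slack-or-> x y ε 0<ε
  with cauchy x (½ ℚ.* (½ ℚ.* (½ ℚ.* ε))) (half-positive (half-positive (half-positive 0<ε)))
     | cauchy y (½ ℚ.* (½ ℚ.* (½ ℚ.* ε))) (half-positive (half-positive (half-positive 0<ε)))
... | M , hx | N , hy = case (seq x k ℚₚ.≤? seq y k ℚ.+ ½ ℚ.* ε)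
  where
  k : ℕ
  k = M ℕ.⊔ N

  near-x : ∀ m → k ℕ.≤ m → ℚ.∣ seq x m ℚ.- seq x k ∣ ℚ.≤ ½ ℚ.* (½ ℚ.* (½ ℚ.* ε))
  near-x m k≤m = hx m k (ℕₚ.m⊔n≤o⇒m≤o M N k≤m) (ℕₚ.m≤m⊔n M N)

  near-y : ∀ m → k ℕ.≤ m → ℚ.∣ seq y m ℚ.- seq y k ∣ ℚ.≤ ½ ℚ.* (½ ℚ.* (½ ℚ.* ε))
  near-y m k≤m = hy m k (ℕₚ.m⊔n≤o⇒n≤o M N k≤m) (ℕₚ.m≤n⊔m M N)

  case : Dec (seq x k ℚ.≤ seq y k ℚ.+ ½ ℚ.* ε) →
    Eventually (λ n → seq x n ℚ.≤ seq y n ℚ.+ ε) ⊎ y < x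
  case (yes xk≤yk) = inj₁ (k , λ m k≤m → ≤-difference _
    (+-nonneg (+-nonneg (+-nonneg
      (q≤p⇒p-q≥0 (∣p-q∣≤r⇒p≤q+r (seq x m) (seq x k) (near-x m k≤m)))
      (q≤p⇒p-q≥0 xk≤yk))
      (q≤p⇒p-q≥0 (∣p-q∣≤r⇒p≤q+r (seq y k) (seq y m)
        (subst (ℚ._≤ _) (∣p-q∣≡∣q-p∣ (seq y m) (seq y k)) (near-y m k≤m)))))
      (ℚₚ.<⇒≤ (half-positive (half-positive 0<ε))))
    (solve 5 (λ x y u v ε → (y :+ ε) :- x :=
       (u :+ con ½ :* (con ½ :* (con ½ :* ε)) :- x) :+ (v :+ con ½ :* ε :- u)
         :+ (y :+ con ½ :* (con ½ :* (con ½ :* ε)) :- v) :+ con ½ :* (con ½ :* ε))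
      refl (seq x m) (seq y m) (seq x k) (seq y k) ε))
  case (no xk≰yk) = inj₂ (½ ℚ.* (½ ℚ.* ε) , half-positive (half-positive 0<ε) ,
    k , λ m k≤m → ≤-difference _
    (+-nonneg (+-nonneg
      (q≤p⇒p-q≥0 (∣p-q∣≤r⇒p≤q+r (seq x k) (seq x m)
        (subst (ℚ._≤ _) (∣p-q∣≡∣q-p∣ (seq x m) (seq x k)) (near-x m k≤m))))
      (q≤p⇒p-q≥0 (ℚₚ.<⇒≤ (ℚₚ.≰⇒> xk≰yk))))
      (q≤p⇒p-q≥0 (∣p-q∣≤r⇒p≤q+r (seq y m) (seq y k) (near-y m k≤m))))
    (solve 5 (λ x y u v ε → x :- (y :+ con ½ :* (con ½ :* ε)) :=
       (x :+ con ½ :* (con ½ :* (con ½ :* ε)) :- u) :+ (u :- (v :+ con ½ :* ε))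
         :+ (v :+ con ½ :* (con ½ :* (con ½ :* ε)) :- y))
      refl (seq x m) (seq y m) (seq x k) (seq y k) ε))

<⇒≱ : ∀ {x y} → x < y → ¬ y ≤ x
<⇒≱ {x} {y} (η , 0<η , h) y≤x = eventually-absurd {λ _ → η ℚ.≤ ½ ℚ.* η}
  (λ _ → ℚ-<⇒≱ (subst (½ ℚ.* η ℚ.<_) (half+half η)
    (subst (ℚ._< ½ ℚ.* η ℚ.+ ½ ℚ.* η) (ℚₚ.+-identityʳ (½ ℚ.* η))
      (ℚₚ.+-monoʳ-< (½ ℚ.* η) (half-positive 0<η)))))
  (eventually-zip (λ n p q → ≤-difference _ (+-nonneg (q≤p⇒p-q≥0 p) (q≤p⇒p-q≥0 q))
    (solve 3 (λ x y η → con ½ :* η :- η := (y :- (x :+ η)) :+ (x :+ con ½ :* η :- y))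
      refl (seq x n) (seq y n) η)) h (y≤x (½ ℚ.* η) (half-positive 0<η)))

-- For each ε the second alternative of `≤-slack-or->` is excluded. Together with `<⇒≱` this makes
-- `≤` equivalent to a negation, whence its stability.
≮⇒≥ : ∀ {x y} → ¬ x < y → y ≤ x
≮⇒≥ {x} {y} x≮y ε 0<ε =
  [ id , (λ x<y → contradiction x<y x≮y) ]′ (≤-slack-or-> y x ε 0<ε)

≤-stable : ∀ {x y} → ¬ ¬ x ≤ y → x ≤ y
≤-stable {x} {y} ¬¬x≤y = ≮⇒≥ {y} {x} λ y<x → ¬¬x≤y (<⇒≱ {y} {x} y<x)

<⇒≤ : ∀ {x y} → x < y → x ≤ y
<⇒≤ {x} {y} (η , 0<η , h) ε 0<ε = eventually-map
  (λ n p → ≤-weaken (ℚₚ.<⇒≤ 0<ε) (ℚₚ.≤-trans (≤-weaken (ℚₚ.<⇒≤ 0<η) ℚₚ.≤-refl) p)) h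

≤-total : ∀ x y → ¬ ¬ (x ≤ y ⊎ y ≤ x)
≤-total x y ¬total = ¬total (inj₁ (≮⇒≥ {y} {x} λ y<x → ¬total (inj₂ (<⇒≤ {y} {x} y<x))))

≤-<-trans : ∀ {x y z} → x ≤ y → y < z → x < z
≤-<-trans {x} {y} {z} x≤y (η , 0<η , h) = ½ ℚ.* η , half-positive 0<η ,
  eventually-zip (λ n p q → ≤-difference _ (+-nonneg (q≤p⇒p-q≥0 p) (q≤p⇒p-q≥0 q))
    (solve 4 (λ x y z η → z :- (x :+ con ½ :* η) := (y :+ con ½ :* η :- x) :+ (z :- (y :+ η)))
      refl (seq x n) (seq y n) (seq z n) η))
    (x≤y (½ ℚ.* η) (half-positive 0<η)) h

<-≤-trans : ∀ {x y z} → x < y → y ≤ z → x < z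
<-≤-trans {x} {y} {z} (η , 0<η , h) y≤z = ½ ℚ.* η , half-positive 0<η ,
  eventually-zip (λ n p q → ≤-difference _ (+-nonneg (q≤p⇒p-q≥0 p) (q≤p⇒p-q≥0 q))
    (solve 4 (λ x y z η → z :- (x :+ con ½ :* η) := (y :- (x :+ η)) :+ (z :+ con ½ :* η :- y))
      refl (seq x n) (seq y n) (seq z n) η))
    h (y≤z (½ ℚ.* η) (half-positive 0<η))

eventually-bounded : ∀ x → ∃[ B ] 0ℚ ℚ.< B × Eventually (λ n → ℚ.∣ seq x n ∣ ℚ.≤ B)
eventually-bounded x with cauchy x 1ℚ 0<1ℚ
... | N , h = ℚ.∣ seq x N ∣ ℚ.+ 1ℚ , ℚₚ.+-mono-≤-< (ℚₚ.0≤∣p∣ (seq x N)) 0<1ℚ , N , λ n N≤n → begin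
  ℚ.∣ seq x n ∣
    ≡⟨ cong ℚ.∣_∣ (solve 2 (λ a b → b :+ (a :- b) := a) refl (seq x n) (seq x N)) ⟨
  ℚ.∣ seq x N ℚ.+ (seq x n ℚ.- seq x N) ∣
    ≤⟨ ℚₚ.∣p+q∣≤∣p∣+∣q∣ (seq x N) (seq x n ℚ.- seq x N) ⟩
  ℚ.∣ seq x N ∣ ℚ.+ ℚ.∣ seq x n ℚ.- seq x N ∣
    ≤⟨ ℚₚ.+-monoʳ-≤ ℚ.∣ seq x N ∣ (h n N N≤n ℕₚ.≤-refl) ⟩
  ℚ.∣ seq x N ∣ ℚ.+ 1ℚ ∎
  where open ℚₚ.≤-Reasoning

*-congˡ : ∀ z {x y} → x ≈ y → z * x ≈ z * y
*-congˡ z {x} {y} x≈y ε 0<ε =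
  let B , 0<B , z≤B = eventually-bounded z
      η , 0<η , Bη≡ε = divide-positive 0<B 0<ε
  in eventually-zip (λ n ∣z∣≤B ∣x-y∣≤η → begin
  ℚ.∣ seq z n ℚ.* seq x n ℚ.- seq z n ℚ.* seq y n ∣
    ≡⟨ cong ℚ.∣_∣ (solve 3 (λ z x y → z :* x :- z :* y := z :* (x :- y)) refl
         (seq z n) (seq x n) (seq y n)) ⟩
  ℚ.∣ seq z n ℚ.* (seq x n ℚ.- seq y n) ∣
    ≡⟨ ℚₚ.∣p*q∣≡∣p∣*∣q∣ (seq z n) (seq x n ℚ.- seq y n) ⟩
  ℚ.∣ seq z n ∣ ℚ.* ℚ.∣ seq x n ℚ.- seq y n ∣
    ≤⟨ *-monoʳ-≤ _ (ℚₚ.0≤∣p∣ (seq x n ℚ.- seq y n)) ∣z∣≤B ⟩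
  B ℚ.* ℚ.∣ seq x n ℚ.- seq y n ∣
    ≤⟨ *-monoˡ-≤ B (ℚₚ.<⇒≤ 0<B) ∣x-y∣≤η ⟩
  B ℚ.* η
    ≡⟨ Bη≡ε ⟩
  ε ∎) z≤B (x≈y η 0<η)
  where open ℚₚ.≤-Reasoning

*-comm : ∀ x y → x * y ≈ y * x
*-comm x y = pointwise-≈ {x * y} {y * x} (λ n → ℚₚ.*-comm (seq x n) (seq y n))

*-congʳ : ∀ z {x y} → x ≈ y → x * z ≈ y * z
*-congʳ z {x} {y} x≈y = ≈-trans {x * z} {z * x} {y * z} (*-comm x z)
  (≈-trans {z * x} {z * y} {y * z} (*-congˡ z {x} {y} x≈y) (*-comm z y))

*-cong : ∀ {x y u v} → x ≈ y → u ≈ v → x * u ≈ y * v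
*-cong {x} {y} {u} {v} x≈y u≈v = ≈-trans {x * u} {y * u} {y * v}
  (*-congʳ u {x} {y} x≈y) (*-congˡ y {u} {v} u≈v)

*-monoˡ-<-pos : ∀ z {x y} → 0ℝ < z → x < y → z * x < z * y
*-monoˡ-<-pos z {x} {y} (η , 0<η , h) (θ , 0<θ , g) = η ℚ.* θ , *-positive 0<η 0<θ ,
  eventually-zip (λ n p q → ≤-difference _
    (+-nonneg (*-nonneg (q≤p⇒p-q≥0 p) (ℚₚ.≤-trans (ℚₚ.<⇒≤ 0<θ) (shift q)))
              (*-nonneg (ℚₚ.<⇒≤ 0<η) (q≤p⇒p-q≥0 q)))
    (solve 5 (λ z x y η θ → z :* y :- (z :* x :+ η :* θ) :=
        (z :- (con 0ℚ :+ η)) :* (y :- x) :+ η :* (y :- (x :+ θ)))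
      refl (seq z n) (seq x n) (seq y n) η θ)) h g
  where
  shift : ∀ {a b c} → a ℚ.+ b ℚ.≤ c → b ℚ.≤ c ℚ.- a
  shift {a} {b} {c} a+b≤c = ≤-difference _ (q≤p⇒p-q≥0 a+b≤c)
    (solve 3 (λ a b c → (c :- a) :- b := c :- (a :+ b)) refl a b c)

*-cancelˡ-≤-pos : ∀ z {x y} → 0ℝ < z → z * x ≤ z * y → x ≤ y
*-cancelˡ-≤-pos z {x} {y} 0<z zx≤zy = ≮⇒≥ {y} {x} λ y<x →
  <⇒≱ {z * y} {z * x} (*-monoˡ-<-pos z {y} {x} 0<z y<x) zx≤zy

*-monoˡ-≤-nonneg : ∀ z {x y} → 0ℝ ≤ z → x ≤ y → z * x ≤ z * y
*-monoˡ-≤-nonneg z {x} {y} 0≤z x≤y = ≤-stable {z * x} {z * y} λ zx≰zy →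
  let x≮y : 0ℝ < z → ¬ x < y
      x≮y = λ 0<z x<y → zx≰zy (<⇒≤ {z * x} {z * y} (*-monoˡ-<-pos z {x} {y} 0<z x<y))
      0≮z : ¬ 0ℝ < z
      0≮z = λ 0<z → zx≰zy (≈⇒≤ {z * x} {z * y}
        (*-congˡ z {x} {y} (≤-antisym {x} {y} x≤y (≮⇒≥ {x} {y} (x≮y 0<z)))))
      z≈0 : z ≈ 0ℝ
      z≈0 = ≤-antisym {z} {0ℝ} (≮⇒≥ {0ℝ} {z} 0≮z) 0≤z
      zu≈0 : ∀ u → z * u ≈ 0ℝ
      zu≈0 = λ u → ≈-trans {z * u} {0ℝ * u} {0ℝ} (*-congʳ u {z} {0ℝ} z≈0)
        (pointwise-≈ {0ℝ * u} {0ℝ} (λ n → ℚₚ.*-zeroˡ (seq u n)))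
  in zx≰zy (≤-trans {z * x} {0ℝ} {z * y} (≈⇒≤ {z * x} {0ℝ} (zu≈0 x)) (≈⇒≥ {z * y} {0ℝ} (zu≈0 y)))

square-cancel-≤ : ∀ {x y} → 0ℝ ≤ y → x * x ≤ y * y → x ≤ y
square-cancel-≤ {x} {y} 0≤y x²≤y² = ≮⇒≥ {y} {x} λ y<x →
  let 0<x : 0ℝ < x
      0<x = ≤-<-trans {0ℝ} {y} {x} 0≤y y<x
      yy≤yx : y * y ≤ y * x
      yy≤yx = *-monoˡ-≤-nonneg y {y} {x} 0≤y (<⇒≤ {y} {x} y<x)
      yx≤xy : y * x ≤ x * y
      yx≤xy = ≈⇒≤ {y * x} {x * y} (*-comm y x)
  in <⇒≱ {y * y} {x * x}
       (≤-<-trans {y * y} {x * y} {x * x} (≤-trans {y * y} {y * x} {x * y} yy≤yx yx≤xy)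
         (*-monoˡ-<-pos x {y} {x} 0<x y<x))
       x²≤y²

square≤0⇒≈0 : ∀ {x} → x * x ≤ 0ℝ → x ≈ 0ℝ
square≤0⇒≈0 {x} x²≤0 ε 0<ε = eventually-map
  (λ n x²≤ε² → subst (λ y → ℚ.∣ y ∣ ℚ.≤ ε) (sym (ℚₚ.+-identityʳ (seq x n)))
    (small (seq x n) (ℚₚ.≤-trans x²≤ε² (ℚₚ.≤-reflexive (ℚₚ.+-identityˡ (ε ℚ.* ε))))))
  -- Slack ε² for the square gives accuracy ε for `x`, since p² ≤ ε² forces |p| ≤ ε.
  (x²≤0 (ε ℚ.* ε) (*-positive 0<ε 0<ε))
  where
  small : ∀ p → p ℚ.* p ℚ.≤ ε ℚ.* ε → ℚ.∣ p ∣ ℚ.≤ ε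
  small p p²≤ε² with ℚ.∣ p ∣ ℚₚ.≤? ε
  ... | yes ∣p∣≤ε = ∣p∣≤ε
  ... | no  ∣p∣≰ε = contradiction p²≤ε² (ℚ-<⇒≱ (begin-strict
    ε ℚ.* ε                ≤⟨ *-monoˡ-≤ ε (ℚₚ.<⇒≤ 0<ε) (ℚₚ.<⇒≤ ε<∣p∣) ⟩
    ε ℚ.* ℚ.∣ p ∣          <⟨ ℚₚ.*-monoˡ-<-pos ℚ.∣ p ∣ {{ℚ.positive (ℚₚ.<-trans 0<ε ε<∣p∣)}} ε<∣p∣ ⟩
    ℚ.∣ p ∣ ℚ.* ℚ.∣ p ∣    ≡⟨ ℚₚ.∣p*q∣≡∣p∣*∣q∣ p p ⟨
    ℚ.∣ p ℚ.* p ∣          ≡⟨ ℚₚ.0≤p⇒∣p∣≡p (square-nonneg p) ⟩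
    p ℚ.* p                ∎))
    where
    open ℚₚ.≤-Reasoning
    ε<∣p∣ : ε ℚ.< ℚ.∣ p ∣
    ε<∣p∣ = ℚₚ.≰⇒> ∣p∣≰ε

fromℕ-mono-≤ : ∀ {a b} → a ℕ.≤ b → fromℕ a ≤ fromℕ b
fromℕ-mono-≤ {a} {b} a≤b = pointwise-≤ {fromℕ a} {fromℕ b} (λ _ → ι-mono-≤ a≤b)

fromℕ-mono-< : ∀ {a b} → a ℕ.< b → fromℕ a < fromℕ b
fromℕ-mono-< {a} {b} a<b = 1ℚ , 0<1ℚ , always λ _ →
  subst (ℚ._≤ ι b) (trans (ι-suc a) (ℚₚ.+-comm 1ℚ (ι a))) (ι-mono-≤ a<b)

fromℕ-cancel-≤ : ∀ {a b} → fromℕ a ≤ fromℕ b → a ℕ.≤ b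
fromℕ-cancel-≤ {a} {b} h = ℕₚ.≮⇒≥ λ b<a → <⇒≱ {fromℕ b} {fromℕ a} (fromℕ-mono-< b<a) h

sumᴿ : ∀ {n} → Vector ℝ n → ℝ
sumᴿ {zero}  f = 0ℝ
sumᴿ {suc n} f = f Fin.zero + sumᴿ (f ∘ Fin.suc)

seq-sumᴿ : ∀ {n} (f : Vector ℝ n) k → seq (sumᴿ f) k ≡ sum (λ i → seq (f i) k)
seq-sumᴿ {zero}  f k = refl
seq-sumᴿ {suc n} f k = cong (seq (f Fin.zero) k ℚ.+_) (seq-sumᴿ (f ∘ Fin.suc) k)

sumᴿ-mono-≤ : ∀ {n} {f g : Vector ℝ n} → (∀ i → f i ≤ g i) → sumᴿ f ≤ sumᴿ g
sumᴿ-mono-≤ {zero}          f≤g = ≤-refl {0ℝ}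
sumᴿ-mono-≤ {suc n} {f} {g} f≤g =
  +-mono-≤ {f Fin.zero} {g Fin.zero} {sumᴿ (f ∘ Fin.suc)} {sumᴿ (g ∘ Fin.suc)}
    (f≤g Fin.zero) (sumᴿ-mono-≤ {f = f ∘ Fin.suc} {g ∘ Fin.suc} (f≤g ∘ Fin.suc))

+-cancel-≤ : ∀ {x y u v} → x ≤ y → y + v ≤ x + u → v ≤ u
+-cancel-≤ {x} {y} {u} {v} x≤y h ε 0<ε = eventually-zip
  (λ n p q → ≤-difference _ (+-nonneg (q≤p⇒p-q≥0 p) (q≤p⇒p-q≥0 q))
    (solve 5 (λ x y u v ε → (u :+ ε) :- v :=
        (y :+ con ½ :* ε :- x) :+ (x :+ u :+ con ½ :* ε :- (y :+ v)))
      refl (seq x n) (seq y n) (seq u n) (seq v n) ε))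
  (x≤y (½ ℚ.* ε) (half-positive 0<ε)) (h (½ ℚ.* ε) (half-positive 0<ε))

-- A deficit in one term cannot be made up by the others: cancelling the tails settles the head, and
-- cancelling the heads passes the hypothesis on to the tails. The equality cases `*ʳ-least-tight`
-- and `*ʳ-greatest-tight` rest on this.
sumᴿ-tight : ∀ {n} {f g : Vector ℝ n} → (∀ i → f i ≤ g i) → sumᴿ g ≤ sumᴿ f → ∀ i → g i ≤ f i
sumᴿ-tight {suc n} {f} {g} f≤g ∑g≤∑f = λ where
    Fin.zero    → +-cancel-≤ {sumᴿ f′} {sumᴿ g′} {f Fin.zero} {g Fin.zero} tails
      (≤-trans {sumᴿ g′ + g Fin.zero} {sumᴿ g} {sumᴿ f′ + f Fin.zero}
        (swap (sumᴿ g′) (g Fin.zero))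
        (≤-trans {sumᴿ g} {sumᴿ f} {sumᴿ f′ + f Fin.zero} ∑g≤∑f (swap (f Fin.zero) (sumᴿ f′))))
    (Fin.suc i) → sumᴿ-tight {f = f′} {g′} (f≤g ∘ Fin.suc)
      (+-cancel-≤ {f Fin.zero} {g Fin.zero} {sumᴿ f′} {sumᴿ g′} (f≤g Fin.zero) ∑g≤∑f) i
  where
  f′ g′ : Vector ℝ n
  f′ = f ∘ Fin.suc
  g′ = g ∘ Fin.suc

  tails : sumᴿ f′ ≤ sumᴿ g′
  tails = sumᴿ-mono-≤ {f = f′} {g′} (f≤g ∘ Fin.suc)

  swap : ∀ x y → x + y ≤ y + x
  swap x y = pointwise-≤ {x + y} {y + x} (λ n → ℚₚ.≤-reflexive (ℚₚ.+-comm (seq x n) (seq y n)))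

-- Two reals are comparable only up to double negation, so an extremal entry exists only in that
-- sense. The order is a parameter so that its converse yields least entries.
maximal-index : ∀ {n} {_≼_ : ℝ → ℝ → Set} → (∀ {x} → x ≼ x) →
  (∀ {x y z} → x ≼ y → y ≼ z → x ≼ z) → (∀ x y → ¬ ¬ (x ≼ y ⊎ y ≼ x)) →
  (f : Vector ℝ (suc n)) → ¬ ¬ (∃[ i ] ∀ j → f j ≼ f i)
maximal-index {zero} rfl tr tot f none =
  none (Fin.zero , λ { Fin.zero → rfl })
maximal-index {suc n} {_≼_} rfl tr tot f none =
  maximal-index {n} {_≼_} rfl tr tot (f ∘ Fin.suc) λ (i , max) →
    tot (f Fin.zero) (f (Fin.suc i)) λ where
      (inj₁ f0≼fi) → none (Fin.suc i , λ { Fin.zero → f0≼fi ; (Fin.suc j) → max j })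
      (inj₂ fi≼f0) → none (Fin.zero , λ { Fin.zero → rfl ; (Fin.suc j) → tr (max j) fi≼f0 })

-- Extremal entries of eigenvectors

rowSum : ∀ {n} → Matrix ℕ n → Fin n → ℕ
rowSum Q i = sumℕ (Q i)

infixl 7 _*ʳ_

_*ʳ_ : ∀ {n} → Matrix ℕ n → Vector ℝ n → Vector ℝ n
(Q *ʳ a) i = sumᴿ (λ j → fromℕ (Q i j) * a j)

Least Greatest : ∀ {n} → Vector ℝ n → Fin n → Set
Least    a i = ∀ j → a i ≤ a j
Greatest a i = ∀ j → a j ≤ a i

∃-least : ∀ {n} (a : Vector ℝ (suc n)) → ¬ ¬ ∃ (Least a)
∃-least a = maximal-index {_≼_ = λ x y → y ≤ x} (λ {x} → ≤-refl {x})
  (λ {x} {y} {z} y≤x z≤y → ≤-trans {z} {y} {x} z≤y y≤x)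
  (λ x y → ≤-total y x) a

∃-greatest : ∀ {n} (a : Vector ℝ (suc n)) → ¬ ¬ ∃ (Greatest a)
∃-greatest a = maximal-index {_≼_ = _≤_} (λ {x} → ≤-refl {x})
  (λ {x} {y} {z} → ≤-trans {x} {y} {z}) ≤-total a

entry≤sum : ∀ {n} (f : Vector ℕ n) i → f i ℕ.≤ sumℕ f
entry≤sum f Fin.zero    = ℕₚ.m≤m+n (f Fin.zero) _
entry≤sum f (Fin.suc i) = ℕₚ.≤-trans (entry≤sum (f ∘ Fin.suc) i) (ℕₚ.m≤n+m _ (f Fin.zero))

fromℕ-nonneg : ∀ k → 0ℝ ≤ fromℕ k
fromℕ-nonneg k = fromℕ-mono-≤ {0} {k} ℕ.z≤n

fromℕ-positive : ∀ {k} → 1 ℕ.≤ k → 0ℝ < fromℕ k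
fromℕ-positive = fromℕ-mono-<

sumᴿ-*ʳ-constant : ∀ {n} (w : Vector ℕ n) x →
  sumᴿ (λ j → fromℕ (w j) * x) ≈ fromℕ (sumℕ w) * x
sumᴿ-*ʳ-constant w x = pointwise-≈ {sumᴿ (λ j → fromℕ (w j) * x)} {fromℕ (sumℕ w) * x} λ k →
  trans (seq-sumᴿ (λ j → fromℕ (w j) * x) k)
    (trans (sym (*-distribʳ-sum (seq x k) (λ j → ι (w j)))) (cong (ℚ._* seq x k) (sum-ι w)))

module _ {n} (Q : Matrix ℕ n) (a : Vector ℝ n) (i : Fin n) where
  private
    r : ℝ
    r = fromℕ (rowSum Q i)

    constant : ℝ
    constant = sumᴿ (λ j → fromℕ (Q i j) * a i)

    constant≈ : constant ≈ r * a i
    constant≈ = sumᴿ-*ʳ-constant (Q i) (a i)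

  *ʳ-least : Least a i → r * a i ≤ (Q *ʳ a) i
  *ʳ-least least = ≤-trans {r * a i} {constant} {(Q *ʳ a) i}
    (≈⇒≥ {constant} {r * a i} constant≈)
    (sumᴿ-mono-≤ λ j → *-monoˡ-≤-nonneg (fromℕ (Q i j)) {a i} {a j} (fromℕ-nonneg (Q i j)) (least j))

  *ʳ-greatest : Greatest a i → (Q *ʳ a) i ≤ r * a i
  *ʳ-greatest greatest = ≤-trans {(Q *ʳ a) i} {constant} {r * a i}
    (sumᴿ-mono-≤ λ j → *-monoˡ-≤-nonneg (fromℕ (Q i j)) {a j} {a i} (fromℕ-nonneg (Q i j)) (greatest j))
    (≈⇒≤ {constant} {r * a i} constant≈)

  -- Equality in the termwise estimate `*ʳ-least` forces equality in each term, and a weight `Q i j`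
  -- of at least 1 may be cancelled.
  *ʳ-least-tight : Least a i → (Q *ʳ a) i ≤ r * a i → ∀ {j} → 1 ℕ.≤ Q i j → a j ≤ a i
  *ʳ-least-tight least Qa≤ra {j} 1≤Qij = *-cancelˡ-≤-pos (fromℕ (Q i j)) {a j} {a i} (fromℕ-positive 1≤Qij)
    (sumᴿ-tight {f = λ j → fromℕ (Q i j) * a i} {g = λ j → fromℕ (Q i j) * a j}
      (λ j → *-monoˡ-≤-nonneg (fromℕ (Q i j)) {a i} {a j} (fromℕ-nonneg (Q i j)) (least j))
      (≤-trans {(Q *ʳ a) i} {r * a i} {constant} Qa≤ra (≈⇒≥ {constant} {r * a i} constant≈)) j)

  *ʳ-greatest-tight : Greatest a i → r * a i ≤ (Q *ʳ a) i → ∀ {j} → 1 ℕ.≤ Q i j → a i ≤ a j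
  *ʳ-greatest-tight greatest ra≤Qa {j} 1≤Qij = *-cancelˡ-≤-pos (fromℕ (Q i j)) {a i} {a j} (fromℕ-positive 1≤Qij)
    (sumᴿ-tight {f = λ j → fromℕ (Q i j) * a j} {g = λ j → fromℕ (Q i j) * a i}
      (λ j → *-monoˡ-≤-nonneg (fromℕ (Q i j)) {a j} {a i} (fromℕ-nonneg (Q i j)) (greatest j))
      (≤-trans {constant} {r * a i} {(Q *ʳ a) i} (≈⇒≤ {constant} {r * a i} constant≈) ra≤Qa) j)

Irreducible : ∀ {n} → Matrix ℕ n → Set
Irreducible Q = ∀ i j → Star (λ i j → 1 ℕ.≤ Q i j) i j

propagate : ∀ {n} {Q : Matrix ℕ n} {P : Fin n → Set} →
  (∀ {i j} → P i → 1 ℕ.≤ Q i j → P j) → ∀ {i j} → Star (λ i j → 1 ℕ.≤ Q i j) i j → P i → P j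
propagate step Star.ε    p = p
propagate step (e ◅ es) p = propagate step es (step p e)

*-assoc-≤ : ∀ x y z → x * (y * z) ≤ z * (x * y)
*-assoc-≤ x y z = pointwise-≤ {x * (y * z)} {z * (x * y)} λ k → ℚₚ.≤-reflexive
  (solve 3 (λ x y z → x :* (y :* z) := z :* (x :* y)) refl (seq x k) (seq y k) (seq z k))

-- a plays the rôle of the squared moduli of an eigenvector; the subeigenvector
-- inequality is squared because no square roots are available.
module SquaredSubeigenvector {n} (Q : Matrix ℕ (suc n)) (ρ : ℝ) (0≤ρ : 0ℝ ≤ ρ)
  (a : Vector ℝ (suc n)) (¬a≤0 : ¬ (∀ i → a i ≤ 0ℝ))
  (sub : ∀ i → a i * (ρ * ρ) ≤ fromℕ (rowSum Q i) * (Q *ʳ a) i)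
  where
  private
    r : Vector ℝ (suc n)
    r i = fromℕ (rowSum Q i)

  greatest-positive : ∀ {i} → Greatest a i → ¬ ¬ 0ℝ < a i
  greatest-positive {i} greatest 0≮ai =
    ¬a≤0 λ j → ≤-trans {a j} {a i} {0ℝ} (greatest j) (≮⇒≥ {0ℝ} {a i} 0≮ai)

  -- aᵢρ² ≤ rᵢ(Qa)ᵢ ≤ rᵢ²aᵢ; the positive aᵢ is cancelled first, then the squares.
  radius≤rowSum : ∀ {i} → Greatest a i → ρ ≤ fromℕ (rowSum Q i)
  radius≤rowSum {i} greatest = ≤-stable {ρ} {r i} λ ρ≰r → greatest-positive greatest λ 0<ai →
    ρ≰r (square-cancel-≤ {ρ} {r i} (fromℕ-nonneg (rowSum Q i))
      (*-cancelˡ-≤-pos (a i) {ρ * ρ} {r i * r i} 0<ai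
        (≤-trans {a i * (ρ * ρ)} {r i * (Q *ʳ a) i} {a i * (r i * r i)} (sub i)
          (≤-trans {r i * (Q *ʳ a) i} {r i * (r i * a i)} {a i * (r i * r i)}
            (*-monoˡ-≤-nonneg (r i) {(Q *ʳ a) i} {r i * a i} (fromℕ-nonneg (rowSum Q i))
              (*ʳ-greatest Q a i greatest))
            (*-assoc-≤ (r i) (r i) (a i))))))

  -- With rᵢ ≤ ρ the chain closes up: rᵢ²aᵢ ≤ aᵢρ² ≤ rᵢ(Qa)ᵢ. The entry `Q i j` makes rᵢ positive,
  -- and cancelling it leaves the equality case of `*ʳ-greatest`.
  greatest-spreads : ∀ {i j} → fromℕ (rowSum Q i) ≤ ρ → Greatest a i → 1 ℕ.≤ Q i j → Greatest a j
  greatest-spreads {i} {j} r≤ρ greatest 1≤Qij k = ≤-stable {a k} {a j} λ ak≰aj →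
    greatest-positive greatest λ 0<ai → ak≰aj (≤-trans {a k} {a i} {a j} (greatest k)
      (*ʳ-greatest-tight Q a i greatest (ra≤Qa 0<ai) 1≤Qij))
    where
    0≤r : 0ℝ ≤ r i
    0≤r = fromℕ-nonneg (rowSum Q i)

    rr≤ρρ : r i * r i ≤ ρ * ρ
    rr≤ρρ = ≤-trans {r i * r i} {r i * ρ} {ρ * ρ} (*-monoˡ-≤-nonneg (r i) {r i} {ρ} 0≤r r≤ρ)
      (≤-trans {r i * ρ} {ρ * r i} {ρ * ρ} (≈⇒≤ {r i * ρ} {ρ * r i} (*-comm (r i) ρ))
        (*-monoˡ-≤-nonneg ρ {r i} {ρ} 0≤ρ r≤ρ))

    ra≤Qa : 0ℝ < a i → r i * a i ≤ (Q *ʳ a) i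
    ra≤Qa 0<ai = *-cancelˡ-≤-pos (r i) {r i * a i} {(Q *ʳ a) i}
      (fromℕ-positive (ℕₚ.≤-trans 1≤Qij (entry≤sum (Q i) j)))
      (≤-trans {r i * (r i * a i)} {a i * (ρ * ρ)} {r i * (Q *ʳ a) i}
        (≤-trans {r i * (r i * a i)} {a i * (r i * r i)} {a i * (ρ * ρ)}
          (*-assoc-≤ (r i) (r i) (a i))
          (*-monoˡ-≤-nonneg (a i) {r i * r i} {ρ * ρ} (<⇒≤ {0ℝ} {a i} 0<ai) rr≤ρρ))
        (sub i))

  radius≤ : ∀ c → (∀ i → rowSum Q i ℕ.≤ c) → ρ ≤ fromℕ c
  radius≤ c r≤c = ≤-stable {ρ} {fromℕ c} λ ρ≰c → ∃-greatest a λ (i , greatest) →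
    ρ≰c (≤-trans {ρ} {r i} {fromℕ c} (radius≤rowSum greatest) (fromℕ-mono-≤ (r≤c i)))

  -- Every row sum is at most `c` and hence at most ρ, so the property of being greatest spreads
  -- along walks to every index, and `radius≤rowSum` applies at each of them.
  radius≥⇒rowSum≥ : ∀ c → Irreducible Q → (∀ i → rowSum Q i ℕ.≤ c) → fromℕ c ≤ ρ →
    ∀ i → c ℕ.≤ rowSum Q i
  radius≥⇒rowSum≥ c irreducible r≤c c≤ρ i = ℕₚ.≮⇒≥ λ ri<c →
    ∃-greatest a λ (k , greatest) → ℕₚ.<⇒≱ ri<c (fromℕ-cancel-≤
      (≤-trans {fromℕ c} {ρ} {r i} c≤ρ (radius≤rowSum
        (propagate {P = Greatest a} (λ {i} {j} → greatest-spreads {i} {j}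
          (≤-trans {r i} {fromℕ c} {ρ} (fromℕ-mono-≤ (r≤c i)) c≤ρ)) (irreducible k i) greatest))))

module NonnegativeEigenvector {n} (Q : Matrix ℕ (suc n)) (irreducible : Irreducible Q) (ρ : ℝ)
  (a : Vector ℝ (suc n)) (0≤a : ∀ i → 0ℝ ≤ a i) (¬a≤0 : ¬ (∀ i → a i ≤ 0ℝ))
  (eigen : ∀ i → (Q *ʳ a) i ≈ a i * ρ)
  where
  private
    r : Vector ℝ (suc n)
    r i = fromℕ (rowSum Q i)

  -- The hypothesis is multiplied by `a i` so as to cover two situations: ρ ≤ rᵢ, and a vanishing
  -- `a i`, which is the case needed in `positive`.
  least-spreads : ∀ {i j} → a i * ρ ≤ a i * r i → Least a i → 1 ℕ.≤ Q i j → a j ≤ a i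
  least-spreads {i} {j} aρ≤ar least = *ʳ-least-tight Q a i least
    (≤-trans {(Q *ʳ a) i} {a i * ρ} {r i * a i} (≈⇒≤ {(Q *ʳ a) i} {a i * ρ} (eigen i))
      (≤-trans {a i * ρ} {a i * r i} {r i * a i} aρ≤ar
        (≈⇒≤ {a i * r i} {r i * a i} (*-comm (a i) (r i)))))

  -- In a nonnegative vector a vanishing entry is least. It would spread along walks to all entries,
  -- against `¬a≤0`.
  positive : ∀ i → ¬ ¬ 0ℝ < a i
  positive i 0≮ai = ¬a≤0 λ j → propagate {P = λ i → a i ≤ 0ℝ} (λ {i} {j} ai≤0 1≤Qij →
      ≤-trans {a j} {a i} {0ℝ} (least-spreads
        (≈⇒≤ {a i * ρ} {a i * r i} (annihilate ai≤0 ρ (r i)))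
        (λ k → ≤-trans {a i} {0ℝ} {a k} ai≤0 (0≤a k)) 1≤Qij) ai≤0)
    (irreducible i j) (≮⇒≥ {0ℝ} {a i} 0≮ai)
    where
    annihilate : ∀ {i} → a i ≤ 0ℝ → ∀ x y → a i * x ≈ a i * y
    annihilate {i} ai≤0 x y = ≈-trans {a i * x} {0ℝ * x} {a i * y} (*-congʳ x {a i} {0ℝ} ai≈0)
      (≈-trans {0ℝ * x} {0ℝ * y} {a i * y}
        (pointwise-≈ {0ℝ * x} {0ℝ * y} λ k →
          trans (ℚₚ.*-zeroˡ (seq x k)) (sym (ℚₚ.*-zeroˡ (seq y k))))
        (*-congʳ y {0ℝ} {a i} (≈-sym {a i} {0ℝ} ai≈0)))
      where
      ai≈0 : a i ≈ 0ℝ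
      ai≈0 = ≤-antisym {a i} {0ℝ} ai≤0 (0≤a i)

  rowSum≤eigenvalue : ∀ {i} → Least a i → fromℕ (rowSum Q i) ≤ ρ
  rowSum≤eigenvalue {i} least = ≤-stable {r i} {ρ} λ r≰ρ → positive i λ 0<ai →
    r≰ρ (*-cancelˡ-≤-pos (a i) {r i} {ρ} 0<ai
      (≤-trans {a i * r i} {r i * a i} {a i * ρ} (≈⇒≤ {a i * r i} {r i * a i} (*-comm (a i) (r i)))
        (≤-trans {r i * a i} {(Q *ʳ a) i} {a i * ρ} (*ʳ-least Q a i least)
          (≈⇒≤ {(Q *ʳ a) i} {a i * ρ} (eigen i)))))

  eigenvalue≥ : ∀ c → (∀ i → c ℕ.≤ rowSum Q i) → fromℕ c ≤ ρ
  eigenvalue≥ c c≤r = ≤-stable {fromℕ c} {ρ} λ c≰ρ → ∃-least a λ (i , least) →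
    c≰ρ (≤-trans {fromℕ c} {r i} {ρ} (fromℕ-mono-≤ (c≤r i)) (rowSum≤eigenvalue least))

  eigenvalue≤⇒rowSum≤ : ∀ c → (∀ i → c ℕ.≤ rowSum Q i) → ρ ≤ fromℕ c → ∀ i → rowSum Q i ℕ.≤ c
  eigenvalue≤⇒rowSum≤ c c≤r ρ≤c i = ℕₚ.≮⇒≥ λ c<ri →
    ∃-least a λ (k , least) → ℕₚ.<⇒≱ c<ri (fromℕ-cancel-≤
      (≤-trans {r i} {ρ} {fromℕ c} (rowSum≤eigenvalue
        (propagate {P = Least a} (λ {i} {j} leastᵢ 1≤Qij k → ≤-trans {a j} {a i} {a k}
          (least-spreads (*-monoˡ-≤-nonneg (a i) {ρ} {r i} (0≤a i)
            (≤-trans {ρ} {fromℕ c} {r i} ρ≤c (fromℕ-mono-≤ (c≤r i)))) leastᵢ 1≤Qij)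
          (leastᵢ k)) (irreducible k i) least)) ρ≤c))

-- Complex eigenvectors and squared moduli

seq-re-sumᶜ : ∀ {n} (w : Vector ℂ n) k → seq (re (sumᶜ w)) k ≡ sum (λ j → seq (re (w j)) k)
seq-re-sumᶜ {zero}  w k = refl
seq-re-sumᶜ {suc n} w k = cong (seq (re (w Fin.zero)) k ℚ.+_) (seq-re-sumᶜ (w ∘ Fin.suc) k)

seq-im-sumᶜ : ∀ {n} (w : Vector ℂ n) k → seq (im (sumᶜ w)) k ≡ sum (λ j → seq (im (w j)) k)
seq-im-sumᶜ {zero}  w k = refl
seq-im-sumᶜ {suc n} w k = cong (seq (im (w Fin.zero)) k ℚ.+_) (seq-im-sumᶜ (w ∘ Fin.suc) k)

module _ {n} (Q : Matrix ℕ n) (v : Vector ℂ n) (i : Fin n) (k : ℕ) where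

  seq-re-*ᵛ : seq (re (((λ i j → fromℕᶜ (Q i j)) *ᵛ v) i)) k ≡ sum (λ j → ι (Q i j) ℚ.* seq (re (v j)) k)
  seq-re-*ᵛ = trans (seq-re-sumᶜ (λ j → fromℕᶜ (Q i j) *ᶜ v j) k) (sum-cong-≗ λ j →
    solve 3 (λ q x y → q :* x :- con 0ℚ :* y := q :* x) refl
      (ι (Q i j)) (seq (re (v j)) k) (seq (im (v j)) k))

  seq-im-*ᵛ : seq (im (((λ i j → fromℕᶜ (Q i j)) *ᵛ v) i)) k ≡ sum (λ j → ι (Q i j) ℚ.* seq (im (v j)) k)
  seq-im-*ᵛ = trans (seq-im-sumᶜ (λ j → fromℕᶜ (Q i j) *ᶜ v j) k) (sum-cong-≗ λ j →
    solve 3 (λ q x y → q :* y :+ con 0ℚ :* x := q :* y) refl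
      (ι (Q i j)) (seq (re (v j)) k) (seq (im (v j)) k))

∣_∣² : ℂ → ℝ
∣ z ∣² = re z * re z + im z * im z

∣∣²-cong : ∀ {z w} → z ≈ᶜ w → ∣ z ∣² ≈ ∣ w ∣²
∣∣²-cong {z} {w} (re≈ , im≈) = +-cong {re z * re z} {re w * re w} {im z * im z} {im w * im w}
  (*-cong {re z} {re w} {re z} {re w} re≈ re≈) (*-cong {im z} {im w} {im z} {im w} im≈ im≈)

-- The Brahmagupta-Fibonacci identity, entry by entry.
∣∣²-homo-* : ∀ z w → ∣ w ∣² * ∣ z ∣² ≈ ∣ z *ᶜ w ∣²
∣∣²-homo-* z w = pointwise-≈ {∣ w ∣² * ∣ z ∣²} {∣ z *ᶜ w ∣²} λ k →
  solve 4 (λ a b c d → (c :* c :+ d :* d) :* (a :* a :+ b :* b) :=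
      (a :* c :- b :* d) :* (a :* c :- b :* d) :+ (a :* d :+ b :* c) :* (a :* d :+ b :* c))
    refl (seq (re z) k) (seq (im z) k) (seq (re w) k) (seq (im w) k)

∣∣²≤0⇒≈0 : ∀ {z} → ∣ z ∣² ≤ 0ℝ → z ≈ᶜ 0ᶜ
∣∣²≤0⇒≈0 {z} ∣z∣²≤0 =
    square≤0⇒≈0 {re z} (≤-trans {re z * re z} {∣ z ∣²} {0ℝ}
      (pointwise-≤ {re z * re z} {∣ z ∣²} λ k → ≤-weaken (square-nonneg (seq (im z) k)) ℚₚ.≤-refl) ∣z∣²≤0)
  , square≤0⇒≈0 {im z} (≤-trans {im z * im z} {∣ z ∣²} {0ℝ}
      (pointwise-≤ {im z * im z} {∣ z ∣²} λ k → ℚₚ.≤-trans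
        (≤-weaken (square-nonneg (seq (re z) k)) ℚₚ.≤-refl)
        (ℚₚ.≤-reflexive (ℚₚ.+-comm _ (seq (re z) k ℚ.* seq (re z) k)))) ∣z∣²≤0)

-- Cauchy-Schwarz with weights `Q i j`, applied to real and imaginary parts separately and added;
-- the total weight is the row sum. This takes the place of the triangle inequality, which would
-- involve the moduli themselves.
∣*ᵛ∣²≤ : ∀ {n} (Q : Matrix ℕ n) v i → 1 ℕ.≤ rowSum Q i →
  ∣ ((λ i j → fromℕᶜ (Q i j)) *ᵛ v) i ∣² ≤ fromℕ (rowSum Q i) * (Q *ʳ (λ j → ∣ v j ∣²)) i
∣*ᵛ∣²≤ Q v i 1≤r = pointwise-≤ {∣ ((λ i j → fromℕᶜ (Q i j)) *ᵛ v) i ∣²} {fromℕ (rowSum Q i) * (Q *ʳ (λ j → ∣ v j ∣²)) i} λ k →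
  begin
    seq (re Qv) k ℚ.* seq (re Qv) k ℚ.+ seq (im Qv) k ℚ.* seq (im Qv) k
      ≡⟨ cong₂ (λ x y → x ℚ.* x ℚ.+ y ℚ.* y) (seq-re-*ᵛ Q v i k) (seq-im-*ᵛ Q v i k) ⟩
    ∑ (x k) ℚ.* ∑ (x k) ℚ.+ ∑ (y k) ℚ.* ∑ (y k)
      ≤⟨ ℚₚ.+-mono-≤ (weighted-cauchy-schwarz w (x k) 0≤w 0<W) (weighted-cauchy-schwarz w (y k) 0≤w 0<W) ⟩
    sum w ℚ.* ∑ (λ j → x k j ℚ.* x k j) ℚ.+ sum w ℚ.* ∑ (λ j → y k j ℚ.* y k j)
      ≡⟨ ℚₚ.*-distribˡ-+ (sum w) _ _ ⟨
    sum w ℚ.* (∑ (λ j → x k j ℚ.* x k j) ℚ.+ ∑ (λ j → y k j ℚ.* y k j))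
      ≡⟨ cong₂ ℚ._*_ (sum-ι (Q i)) (sym (∑-distrib-+ (λ j → w j ℚ.* (x k j ℚ.* x k j)) (λ j → w j ℚ.* (y k j ℚ.* y k j)))) ⟩
    ι (rowSum Q i) ℚ.* sum (λ j → w j ℚ.* (x k j ℚ.* x k j) ℚ.+ w j ℚ.* (y k j ℚ.* y k j))
      ≡⟨ cong (ι (rowSum Q i) ℚ.*_) (sum-cong-≗ λ j → sym (ℚₚ.*-distribˡ-+ (w j) _ _)) ⟩
    ι (rowSum Q i) ℚ.* sum (λ j → w j ℚ.* (x k j ℚ.* x k j ℚ.+ y k j ℚ.* y k j))
      ≡⟨ cong (ι (rowSum Q i) ℚ.*_) (seq-sumᴿ (λ j → fromℕ (Q i j) * ∣ v j ∣²) k) ⟨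
    ι (rowSum Q i) ℚ.* seq ((Q *ʳ (λ j → ∣ v j ∣²)) i) k
      ∎
  where
  open ℚₚ.≤-Reasoning

  Qv : ℂ
  Qv = ((λ i j → fromℕᶜ (Q i j)) *ᵛ v) i

  w : Vector ℚ _
  w j = ι (Q i j)

  ∑ : Vector ℚ _ → ℚ
  ∑ f = sum (λ j → w j ℚ.* f j)

  x y : ℕ → Vector ℚ _
  x k j = seq (re (v j)) k
  y k j = seq (im (v j)) k

  0≤w : ∀ j → 0ℚ ℚ.≤ w j
  0≤w j = ι-nonneg (Q i j)

  0<W : 0ℚ ℚ.< sum w
  0<W = subst (0ℚ ℚ.<_) (sym (sum-ι (Q i))) (ι-positive 1≤r)

-- |vᵢ|²ρ² = |μvᵢ|² = |(Qv)ᵢ|², to which `∣*ᵛ∣²≤` applies. The result is the hypothesis `sub` of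
-- `SquaredSubeigenvector`.
eigenvector-subeigenvector : ∀ {n} (Q : Matrix ℕ n) μ (v : Vector ℂ n) ρ → ρ * ρ ≈ ∣ μ ∣² →
  ∀ i → 1 ℕ.≤ rowSum Q i → ((λ i j → fromℕᶜ (Q i j)) *ᵛ v) i ≈ᶜ μ *ᶜ v i →
  ∣ v i ∣² * (ρ * ρ) ≤ fromℕ (rowSum Q i) * (Q *ʳ (λ j → ∣ v j ∣²)) i
eigenvector-subeigenvector Q μ v ρ ρ²≈∣μ∣² i 1≤r eigen =
  ≤-trans {∣ v i ∣² * (ρ * ρ)} {∣ ((λ i j → fromℕᶜ (Q i j)) *ᵛ v) i ∣²} {fromℕ (rowSum Q i) * (Q *ʳ (λ j → ∣ v j ∣²)) i}
    (≤-trans {∣ v i ∣² * (ρ * ρ)} {∣ v i ∣² * ∣ μ ∣²} {∣ ((λ i j → fromℕᶜ (Q i j)) *ᵛ v) i ∣²}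
      (≈⇒≤ {∣ v i ∣² * (ρ * ρ)} {∣ v i ∣² * ∣ μ ∣²} (*-congˡ ∣ v i ∣² {ρ * ρ} {∣ μ ∣²} ρ²≈∣μ∣²))
      (≤-trans {∣ v i ∣² * ∣ μ ∣²} {∣ μ *ᶜ v i ∣²} {∣ ((λ i j → fromℕᶜ (Q i j)) *ᵛ v) i ∣²}
        (≈⇒≤ {∣ v i ∣² * ∣ μ ∣²} {∣ μ *ᶜ v i ∣²} (∣∣²-homo-* μ (v i)))
        (≈⇒≥ {∣ ((λ i j → fromℕᶜ (Q i j)) *ᵛ v) i ∣²} {∣ μ *ᶜ v i ∣²} (∣∣²-cong {((λ i j → fromℕᶜ (Q i j)) *ᵛ v) i} {μ *ᶜ v i} eigen))))
    (∣*ᵛ∣²≤ Q v i 1≤r)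

-- Existence of a nonnegative eigenvector

δ-sym : ∀ {n} (i j : Fin n) → δ i j ≡ δ j i
δ-sym Fin.zero    Fin.zero    = refl
δ-sym Fin.zero    (Fin.suc j) = refl
δ-sym (Fin.suc i) Fin.zero    = refl
δ-sym (Fin.suc i) (Fin.suc j) = δ-sym i j

sum-constant : ∀ n p → sum {n} (λ _ → p) ≡ ι n ℚ.* p
sum-constant zero    p = sym (ℚₚ.*-zeroˡ p)
sum-constant (suc n) p = trans (cong (p ℚ.+_) (sum-constant n p))
  (trans (solve 2 (λ p q → p :+ q :* p := (con 1ℚ :+ q) :* p) refl p (ι n))
    (cong (ℚ._* p) (sym (ι-suc n))))

-- The absolute value of the numerator suffices, as the denominator is at least 1.
archimedean : ∀ p → ∃[ N ] p ℚ.≤ ι N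
archimedean p@(ℚ.mkℚ a d _) = ℤ.∣ a ∣ , ℚₚ.toℚᵘ-cancel-≤ (begin
  ℚ.toℚᵘ p                    ≤⟨ ℚᵘ.*≤* numerators ⟩
  ℚᵘ.mkℚᵘ (+ ℤ.∣ a ∣) 0       ≃⟨ ℚₚ.toℚᵘ-fromℚᵘ (ℚᵘ.mkℚᵘ (+ ℤ.∣ a ∣) 0) ⟨
  ℚ.toℚᵘ (ι ℤ.∣ a ∣)          ∎)
  where
  open ℚᵘₚ.≤-Reasoning
  i≤∣i∣ : ∀ i → i ℤ.≤ + ℤ.∣ i ∣
  i≤∣i∣ (+ n)        = ℤₚ.≤-refl
  i≤∣i∣ ℤ.-[1+ n ]   = ℤ.-≤+

  numerators : a ℤ.* + 1 ℤ.≤ + ℤ.∣ a ∣ ℤ.* + suc d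
  numerators = ℤₚ.≤-trans (ℤₚ.≤-reflexive (ℤₚ.*-identityʳ a)) (ℤₚ.≤-trans (i≤∣i∣ a)
    (ℤₚ.≤-trans (ℤ.+≤+ (ℕₚ.m≤m*n ℤ.∣ a ∣ (suc d)))
      (ℤₚ.≤-reflexive (ℤₚ.pos-* ℤ.∣ a ∣ (suc d)))))

-- Powers of the transposed matrix

module Transpose {n} (Q : Matrix ℕ n) where

  Qᵀ : Vector ℚ n → Vector ℚ n
  Qᵀ z i = sum (λ j → ι (Q j i) ℚ.* z j)

  power : ℕ → Vector ℚ n → Vector ℚ n
  power zero    z = z
  power (suc m) z = Qᵀ (power m z)

  power-+ : ∀ l m z → power (l ℕ.+ m) z ≡ power l (power m z)
  power-+ zero    m z = refl
  power-+ (suc l) m z = cong Qᵀ (power-+ l m z)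

  power-Qᵀ : ∀ m z → power m (Qᵀ z) ≡ Qᵀ (power m z)
  power-Qᵀ zero    z = refl
  power-Qᵀ (suc m) z = cong Qᵀ (power-Qᵀ m z)

  Qᵀ-nonneg : ∀ {z} → (∀ i → 0ℚ ℚ.≤ z i) → ∀ i → 0ℚ ℚ.≤ Qᵀ z i
  Qᵀ-nonneg 0≤z i = sum-nonneg (λ j → *-nonneg (ι-nonneg (Q j i)) (0≤z j))

  power-nonneg : ∀ m {z} → (∀ i → 0ℚ ℚ.≤ z i) → ∀ i → 0ℚ ℚ.≤ power m z i
  power-nonneg zero    0≤z = 0≤z
  power-nonneg (suc m) 0≤z = Qᵀ-nonneg (power-nonneg m 0≤z)

  -- Expansion along the unit vectors; `power m (δ j) i` is the entry (i, j) of the m-th power of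
  -- Qᵀ. Linearity of `power` and of `ratio` is derived from it.
  power-expand : ∀ m z i → power m z i ≡ sum (λ j → z j ℚ.* power m (δ j) i)
  power-expand zero    z i = trans (sym (sum-δ i z)) (sum-cong-≗ λ j → ℚₚ.*-comm (δ j i) (z j))
  power-expand (suc m) z i = begin
    sum (λ l → q l ℚ.* power m z l)
      ≡⟨ sum-cong-≗ (λ l → cong (q l ℚ.*_) (power-expand m z l)) ⟩
    sum (λ l → q l ℚ.* sum (λ j → z j ℚ.* power m (δ j) l))
      ≡⟨ sum-cong-≗ (λ l → *-distribˡ-sum (q l) (λ j → z j ℚ.* power m (δ j) l)) ⟩
    sum (λ l → sum (λ j → q l ℚ.* (z j ℚ.* power m (δ j) l)))
      ≡⟨ ∑-comm (λ l j → q l ℚ.* (z j ℚ.* power m (δ j) l)) ⟩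
    sum (λ j → sum (λ l → q l ℚ.* (z j ℚ.* power m (δ j) l)))
      ≡⟨ sum-cong-≗ (λ j → sum-cong-≗ λ l →
           solve 3 (λ q z p → q :* (z :* p) := z :* (q :* p)) refl (q l) (z j) (power m (δ j) l)) ⟩
    sum (λ j → sum (λ l → z j ℚ.* (q l ℚ.* power m (δ j) l)))
      ≡⟨ sum-cong-≗ (λ j → *-distribˡ-sum (z j) (λ l → q l ℚ.* power m (δ j) l)) ⟨
    sum (λ j → z j ℚ.* power (suc m) (δ j) i) ∎
    where
    open ≡-Reasoning
    q : Vector ℚ n
    q l = ι (Q l i)

  power-linear : ∀ m p q y z i →
    power m (λ j → p ℚ.* y j ℚ.+ q ℚ.* z j) i ≡ p ℚ.* power m y i ℚ.+ q ℚ.* power m z i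
  power-linear m p q y z i = begin
    power m (λ j → p ℚ.* y j ℚ.+ q ℚ.* z j) i
      ≡⟨ power-expand m _ i ⟩
    sum (λ j → (p ℚ.* y j ℚ.+ q ℚ.* z j) ℚ.* e j)
      ≡⟨ sum-cong-≗ (λ j → solve 5 (λ p q y z e → (p :* y :+ q :* z) :* e := p :* (y :* e) :+ q :* (z :* e))
           refl p q (y j) (z j) (e j)) ⟩
    sum (λ j → p ℚ.* (y j ℚ.* e j) ℚ.+ q ℚ.* (z j ℚ.* e j))
      ≡⟨ ∑-distrib-+ (λ j → p ℚ.* (y j ℚ.* e j)) (λ j → q ℚ.* (z j ℚ.* e j)) ⟩
    sum (λ j → p ℚ.* (y j ℚ.* e j)) ℚ.+ sum (λ j → q ℚ.* (z j ℚ.* e j))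
      ≡⟨ cong₂ ℚ._+_ (*-distribˡ-sum p (λ j → y j ℚ.* e j)) (*-distribˡ-sum q (λ j → z j ℚ.* e j)) ⟨
    p ℚ.* sum (λ j → y j ℚ.* e j) ℚ.+ q ℚ.* sum (λ j → z j ℚ.* e j)
      ≡⟨ cong₂ (λ s t → p ℚ.* s ℚ.+ q ℚ.* t) (power-expand m y i) (power-expand m z i) ⟨
    p ℚ.* power m y i ℚ.+ q ℚ.* power m z i ∎
    where
    open ≡-Reasoning
    e : Vector ℚ n
    e j = power m (δ j) i

  Qᵀ-δ : ∀ i j → Qᵀ (δ i) j ≡ ι (Q i j)
  Qᵀ-δ i j = trans (sum-cong-≗ λ l → trans (ℚₚ.*-comm (ι (Q l j)) (δ i l)) (cong (ℚ._* ι (Q l j)) (δ-sym i l)))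
    (sum-δ i (λ l → ι (Q l j)))

  arc-≤ : ∀ {z} → (∀ i → 0ℚ ℚ.≤ z i) → ∀ {i j} → 1 ℕ.≤ Q i j → z i ℚ.≤ Qᵀ z j
  arc-≤ {z} 0≤z {i} {j} 1≤Qij = begin
    z i                  ≡⟨ ℚₚ.*-identityˡ (z i) ⟨
    1ℚ ℚ.* z i           ≤⟨ *-monoʳ-≤ (z i) (0≤z i) (ι-mono-≤ 1≤Qij) ⟩
    ι (Q i j) ℚ.* z i    ≤⟨ term≤sum (λ l → *-nonneg (ι-nonneg (Q l j)) (0≤z l)) i ⟩
    Qᵀ z j               ∎
    where open ℚₚ.≤-Reasoning

  length : ∀ {i j} → Star (λ i j → 1 ℕ.≤ Q i j) i j → ℕ
  length Star.ε   = 0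
  length (e ◅ es) = suc (length es)

  walk-≤ : ∀ {z} → (∀ i → 0ℚ ℚ.≤ z i) → ∀ {i j} (w : Star (λ i j → 1 ℕ.≤ Q i j) i j) →
    z i ℚ.≤ power (length w) z j
  walk-≤ 0≤z Star.ε = ℚₚ.≤-refl
  walk-≤ {z} 0≤z {j = j} (e ◅ es) = ℚₚ.≤-trans (arc-≤ 0≤z e)
    (subst (λ u → _ ℚ.≤ u j) (power-Qᵀ (length es) z) (walk-≤ (Qᵀ-nonneg 0≤z) es))

  module _ (1≤diagonal : ∀ i → 1 ℕ.≤ Q i i) where

    stay-≤ : ∀ m {z} → (∀ i → 0ℚ ℚ.≤ z i) → ∀ i → z i ℚ.≤ power m z i
    stay-≤ zero    0≤z i = ℚₚ.≤-refl
    stay-≤ (suc m) 0≤z i = ℚₚ.≤-trans (stay-≤ m 0≤z i) (arc-≤ (power-nonneg m 0≤z) (1≤diagonal i))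

    -- The positive diagonal allows waiting: a walk is prolonged by staying at its end `j` until `m`
    -- steps are made. Thus one exponent serves walks of different lengths.
    reach-≤ : ∀ {z} → (∀ i → 0ℚ ℚ.≤ z i) → ∀ {i j m} (w : Star (λ i j → 1 ℕ.≤ Q i j) i j) →
      length w ℕ.≤ m → z i ℚ.≤ power m z j
    reach-≤ {z} 0≤z {i} {j} {m} w l≤m = begin
      z i                                                ≤⟨ walk-≤ 0≤z w ⟩
      power (length w) z j                               ≤⟨ stay-≤ (m ℕ.∸ length w) (power-nonneg (length w) 0≤z) j ⟩
      power (m ℕ.∸ length w) (power (length w) z) j      ≡⟨ cong (λ u → u j) (power-+ (m ℕ.∸ length w) (length w) z) ⟨
      power ((m ℕ.∸ length w) ℕ.+ length w) z j          ≡⟨ cong (λ k → power k z j) (ℕₚ.m∸n+n≡m l≤m) ⟩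
      power m z j                                        ∎
      where open ℚₚ.≤-Reasoning

  sum-Qᵀ-≤ : ∀ {c z} → (∀ i → rowSum Q i ℕ.≤ c) → (∀ i → 0ℚ ℚ.≤ z i) → sum (Qᵀ z) ℚ.≤ ι c ℚ.* sum z
  sum-Qᵀ-≤ {c} {z} r≤c 0≤z = begin
    sum (λ i → sum (λ j → ι (Q j i) ℚ.* z j))  ≡⟨ ∑-comm (λ i j → ι (Q j i) ℚ.* z j) ⟩
    sum (λ j → sum (λ i → ι (Q j i) ℚ.* z j))  ≡⟨ sum-cong-≗ (λ j → *-distribʳ-sum (z j) (λ i → ι (Q j i))) ⟨
    sum (λ j → sum (λ i → ι (Q j i)) ℚ.* z j)  ≡⟨ sum-cong-≗ (λ j → cong (ℚ._* z j) (sum-ι (Q j))) ⟩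
    sum (λ j → ι (rowSum Q j) ℚ.* z j)         ≤⟨ sum-mono-≤ (λ j → *-monoʳ-≤ (z j) (0≤z j) (ι-mono-≤ (r≤c j))) ⟩
    sum (λ j → ι c ℚ.* z j)                    ≡⟨ *-distribˡ-sum (ι c) z ⟨
    ι c ℚ.* sum z                              ∎
    where open ℚₚ.≤-Reasoning

  growth-bound : ∀ m → ∃[ C ] 1ℚ ℚ.≤ C × (∀ z → (∀ i → 0ℚ ℚ.≤ z i) → sum (power m z) ℚ.≤ C ℚ.* sum z)
  growth-bound zero = 1ℚ , ℚₚ.≤-refl , λ z _ → ℚₚ.≤-reflexive (sym (ℚₚ.*-identityˡ (sum z)))
  growth-bound (suc m) =
    let C , 1≤C , grows = growth-bound m
    in  ι c ℚ.* C
      , ℚₚ.≤-trans 1≤C (subst (ℚ._≤ ι c ℚ.* C) (ℚₚ.*-identityˡ C)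
          (*-monoʳ-≤ C (ℚₚ.≤-trans (ℚₚ.<⇒≤ 0<1ℚ) 1≤C) (ι-mono-≤ {1} {c} (ℕ.s≤s ℕ.z≤n))))
      , λ z 0≤z → ℚₚ.≤-trans (sum-Qᵀ-≤ r≤c (power-nonneg m 0≤z))
          (subst (ι c ℚ.* sum (power m z) ℚ.≤_) (sym (ℚₚ.*-assoc (ι c) C (sum z)))
            (*-monoˡ-≤ (ι c) (ι-nonneg c) (grows z 0≤z)))
    where
    c : ℕ
    -- The successor makes `c` at least 1, which preserves `1 ≤ C` through the induction.
    c = suc (sumℕ (rowSum Q))
    r≤c : ∀ i → rowSum Q i ℕ.≤ c
    r≤c i = ℕₚ.m≤n⇒m≤1+n (entry≤sum (rowSum Q) i)

∣p-q∣≤width : ∀ {p q a b} → a ℚ.≤ p → p ℚ.≤ b → a ℚ.≤ q → q ℚ.≤ b → ℚ.∣ p ℚ.- q ∣ ℚ.≤ b ℚ.- a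
∣p-q∣≤width {p} {q} {a} {b} a≤p p≤b a≤q q≤b = ∣p-q∣≤r p q
  (≤-difference _ (+-nonneg (q≤p⇒p-q≥0 p≤b) (q≤p⇒p-q≥0 a≤q))
    (solve 4 (λ p q a b → (q :+ (b :- a)) :- p := (b :- p) :+ (q :- a)) refl p q a b))
  (≤-difference _ (+-nonneg (q≤p⇒p-q≥0 q≤b) (q≤p⇒p-q≥0 a≤p))
    (solve 4 (λ p q a b → (p :+ (b :- a)) :- q := (b :- q) :+ (p :- a)) refl p q a b))

-- Power iteration with shrinking enclosures

module PowerIteration {n} (Q : Matrix ℕ (suc n)) (m : ℕ)
  (from-base : ∀ z → (∀ i → 0ℚ ℚ.≤ z i) → ∀ i → z Fin.zero ℚ.≤ Transpose.power Q m z i)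
  (to-base : ∀ z → (∀ i → 0ℚ ℚ.≤ z i) → ∀ i → z i ℚ.≤ Transpose.power Q m z Fin.zero)
  (C : ℚ) (1≤C : 1ℚ ℚ.≤ C)
  (grows : ∀ z → (∀ i → 0ℚ ℚ.≤ z i) → sum (Transpose.power Q m z) ℚ.≤ C ℚ.* sum z)
  (θ : ℚ) (0<θ : 0ℚ ℚ.< θ) (θ-small : C ℚ.* (C ℚ.* ι (suc n)) ℚ.* θ ≡ ½)
  where
  open Transpose Q

  0≤C : 0ℚ ℚ.≤ C
  0≤C = ℚₚ.≤-trans (ℚₚ.<⇒≤ 0<1ℚ) 1≤C

  iterate : ℕ → Vector ℚ (suc n) → Vector ℚ (suc n)
  iterate zero    z = z
  iterate (suc k) z = power m (iterate k z)

  iterate-power : ∀ k z → iterate k z ≡ power (k ℕ.* m) z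
  iterate-power zero    z = refl
  iterate-power (suc k) z = trans (cong (power m) (iterate-power k z)) (sym (power-+ m (k ℕ.* m) z))

  iterate-nonneg : ∀ k {z} → (∀ i → 0ℚ ℚ.≤ z i) → ∀ i → 0ℚ ℚ.≤ iterate k z i
  iterate-nonneg zero    0≤z = 0≤z
  iterate-nonneg (suc k) 0≤z = power-nonneg m (iterate-nonneg k 0≤z)

  ones : Vector ℚ (suc n)
  ones _ = 1ℚ

  0≤ones : ∀ i → 0ℚ ℚ.≤ ones i
  0≤ones _ = ℚₚ.<⇒≤ 0<1ℚ

  y : ℕ → Vector ℚ (suc n)
  y k = iterate k ones

  y-nonneg : ∀ k i → 0ℚ ℚ.≤ y k i
  y-nonneg k = iterate-nonneg k 0≤ones

  y-base-positive : ∀ k → 0ℚ ℚ.< y k Fin.zero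
  y-base-positive zero    = 0<1ℚ
  y-base-positive (suc k) = ℚₚ.<-≤-trans (y-base-positive k) (to-base (y k) (y-nonneg k) Fin.zero)

  -- The total mass is comparable to the base entry: one application of S multiplies the sum by at
  -- most `C`, and every entry of `y k` is at most the base entry of `y (suc k)`.
  sum-y-≤ : ∀ k → sum (y k) ℚ.≤ C ℚ.* (ι (suc n) ℚ.* y k Fin.zero)
  sum-y-≤ zero = begin
    sum ones                        ≡⟨ sum-constant (suc n) 1ℚ ⟩
    ι (suc n) ℚ.* 1ℚ                ≡⟨ ℚₚ.*-identityˡ _ ⟨
    1ℚ ℚ.* (ι (suc n) ℚ.* 1ℚ)       ≤⟨ *-monoʳ-≤ _ (*-nonneg (ι-nonneg (suc n)) (ℚₚ.<⇒≤ 0<1ℚ)) 1≤C ⟩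
    C ℚ.* (ι (suc n) ℚ.* 1ℚ)        ∎
    where open ℚₚ.≤-Reasoning
  sum-y-≤ (suc k) = begin
    sum (y (suc k))                              ≤⟨ grows (y k) (y-nonneg k) ⟩
    C ℚ.* sum (y k)                              ≤⟨ *-monoˡ-≤ C 0≤C (sum-mono-≤ (to-base (y k) (y-nonneg k))) ⟩
    C ℚ.* sum {suc n} (λ _ → y (suc k) Fin.zero) ≡⟨ cong (C ℚ.*_) (sum-constant (suc n) (y (suc k) Fin.zero)) ⟩
    C ℚ.* (ι (suc n) ℚ.* y (suc k) Fin.zero)     ∎
    where open ℚₚ.≤-Reasoning

  -- The origin of `θ`: an entry of `y (suc k)` is at most the sum, hence at most C · C · N times
  -- the base entry of `y k`, where N is the number of vertices; and θ = 1 / (2C²N).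
  θ-share : ∀ k i → θ ℚ.* y (suc k) i ℚ.≤ ½ ℚ.* y k Fin.zero
  θ-share k i = begin
    θ ℚ.* y (suc k) i
      ≤⟨ *-monoˡ-≤ θ (ℚₚ.<⇒≤ 0<θ) (ℚₚ.≤-trans (term≤sum (y-nonneg (suc k)) i)
           (ℚₚ.≤-trans (grows (y k) (y-nonneg k)) (*-monoˡ-≤ C 0≤C (sum-y-≤ k)))) ⟩
    θ ℚ.* (C ℚ.* (C ℚ.* (ι (suc n) ℚ.* y k Fin.zero)))
      ≡⟨ solve 4 (λ θ c n y → θ :* (c :* (c :* (n :* y))) := c :* (c :* n) :* θ :* y) refl
           θ C (ι (suc n)) (y k Fin.zero) ⟩
    C ℚ.* (C ℚ.* ι (suc n)) ℚ.* θ ℚ.* y k Fin.zero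
      ≡⟨ cong (ℚ._* y k Fin.zero) θ-small ⟩
    ½ ℚ.* y k Fin.zero ∎
    where open ℚₚ.≤-Reasoning

  θ≤1 : θ ℚ.≤ 1ℚ
  θ≤1 = begin
    θ                          ≡⟨ ℚₚ.*-identityʳ θ ⟨
    θ ℚ.* 1ℚ                   ≤⟨ *-monoˡ-≤ θ (ℚₚ.<⇒≤ 0<θ) (to-base ones 0≤ones Fin.zero) ⟩
    θ ℚ.* y 1 Fin.zero         ≤⟨ θ-share 0 Fin.zero ⟩
    ½ ℚ.* 1ℚ                   ≡⟨ ℚₚ.*-identityʳ ½ ⟩
    ½                          ≤⟨ ≤-difference ½ (ℚₚ.nonNegative⁻¹ ½) refl ⟩
    1ℚ                         ∎
    where open ℚₚ.≤-Reasoning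

  record Enclosure (k : ℕ) (z : Vector ℚ (suc n)) : Set where
    field
      lo hi : ℚ
      lo≤hi : lo ℚ.≤ hi
      lower : ∀ i → lo ℚ.* y k i ℚ.≤ z i
      upper : ∀ i → z i ℚ.≤ hi ℚ.* y k i

    gap : ℚ
    gap = hi ℚ.- lo

    0≤gap : 0ℚ ℚ.≤ gap
    0≤gap = q≤p⇒p-q≥0 lo≤hi

  open Enclosure

  module _ (k : ℕ) (z : Vector ℚ (suc n)) (e : Enclosure k z) where

    -- The distances of `z` from its two bounds, written as the linear combinations that
    -- `power-linear` expects.
    above below : Vector ℚ (suc n)
    above j = (ℚ.- lo e) ℚ.* y k j ℚ.+ 1ℚ ℚ.* z j
    below j = hi e ℚ.* y k j ℚ.+ (ℚ.- 1ℚ) ℚ.* z j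

    above-difference : ∀ p y z → (ℚ.- p) ℚ.* y ℚ.+ 1ℚ ℚ.* z ≡ z ℚ.- p ℚ.* y
    above-difference = solve 3 (λ p y z → (:- p) :* y :+ con 1ℚ :* z := z :- p :* y) refl

    below-difference : ∀ p y z → p ℚ.* y ℚ.+ (ℚ.- 1ℚ) ℚ.* z ≡ p ℚ.* y ℚ.- z
    below-difference = solve 3 (λ p y z → p :* y :+ (:- con 1ℚ) :* z := p :* y :- z) refl

    0≤above : ∀ j → 0ℚ ℚ.≤ above j
    0≤above j = subst (0ℚ ℚ.≤_) (sym (above-difference (lo e) (y k j) (z j))) (q≤p⇒p-q≥0 (lower e j))

    0≤below : ∀ j → 0ℚ ℚ.≤ below j
    0≤below j = subst (0ℚ ℚ.≤_) (sym (below-difference (hi e) (y k j) (z j))) (q≤p⇒p-q≥0 (upper e j))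

    power-above : ∀ l i → power l above i ≡ power l z i ℚ.- lo e ℚ.* power l (y k) i
    power-above l i = trans (power-linear l (ℚ.- lo e) 1ℚ (y k) z i)
      (above-difference (lo e) (power l (y k) i) (power l z i))

    power-below : ∀ l i → power l below i ≡ hi e ℚ.* power l (y k) i ℚ.- power l z i
    power-below l i = trans (power-linear l (hi e) (ℚ.- 1ℚ) (y k) z i)
      (below-difference (hi e) (power l (y k) i) (power l z i))

    lower-power : ∀ l i → lo e ℚ.* power l (y k) i ℚ.≤ power l z i
    lower-power l i = ≤-difference _ (power-nonneg l 0≤above i) (sym (power-above l i))

    upper-power : ∀ l i → power l z i ℚ.≤ hi e ℚ.* power l (y k) i
    upper-power l i = ≤-difference _ (power-nonneg l 0≤below i) (sym (power-below l i))

    -- The base entry reaches every vertex within m steps, and y (suc k) is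
    -- everywhere at most a constant multiple of the base entry of y k.
    lift : ∀ w → (∀ j → 0ℚ ℚ.≤ w j) → ½ ℚ.* (gap e ℚ.* y k Fin.zero) ℚ.≤ w Fin.zero →
      ∀ i → gap e ℚ.* θ ℚ.* y (suc k) i ℚ.≤ power m w i
    lift w 0≤w h i = begin
      gap e ℚ.* θ ℚ.* y (suc k) i         ≡⟨ ℚₚ.*-assoc (gap e) θ _ ⟩
      gap e ℚ.* (θ ℚ.* y (suc k) i)       ≤⟨ *-monoˡ-≤ (gap e) (0≤gap e) (θ-share k i) ⟩
      gap e ℚ.* (½ ℚ.* y k Fin.zero)      ≡⟨ solve 3 (λ g h y → g :* (h :* y) := h :* (g :* y)) refl
                                               (gap e) ½ (y k Fin.zero) ⟩
      ½ ℚ.* (gap e ℚ.* y k Fin.zero)      ≤⟨ h ⟩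
      w Fin.zero                          ≤⟨ from-base w 0≤w i ⟩
      power m w i                         ∎
      where open ℚₚ.≤-Reasoning

    Improved : Enclosure (suc k) (power m z) → Set
    Improved e′ = (lo e ℚ.≤ lo e′) × (hi e′ ℚ.≤ hi e) × (gap e′ ≡ (1ℚ ℚ.- θ) ℚ.* gap e)

    0≤gap*θ : 0ℚ ℚ.≤ gap e ℚ.* θ
    0≤gap*θ = *-nonneg (0≤gap e) (ℚₚ.<⇒≤ 0<θ)

    0≤[1-θ]*gap : 0ℚ ℚ.≤ (1ℚ ℚ.- θ) ℚ.* gap e
    0≤[1-θ]*gap = *-nonneg (q≤p⇒p-q≥0 θ≤1) (0≤gap e)

    -- By `lift`, a surplus over the lower bound at the base vertex becomes a surplus at every
    -- vertex after one application of S, and it pays for raising `lo` by `θ` times the gap.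
    -- `reduce` is the mirror image for `hi`.
    raise : ½ ℚ.* (gap e ℚ.* y k Fin.zero) ℚ.≤ above Fin.zero → ∃ Improved
    raise h = e′
      , ≤-difference _ 0≤gap*θ (solve 2 (λ l g → l :+ g :- l := g) refl (lo e) (gap e ℚ.* θ))
      , ℚₚ.≤-refl , gap-e′
      where
      gap-e′ : hi e ℚ.- (lo e ℚ.+ gap e ℚ.* θ) ≡ (1ℚ ℚ.- θ) ℚ.* gap e
      gap-e′ = solve 3 (λ l h θ → h :- (l :+ (h :- l) :* θ) := (con 1ℚ :- θ) :* (h :- l)) refl (lo e) (hi e) θ
      e′ : Enclosure (suc k) (power m z)
      e′ .lo = lo e ℚ.+ gap e ℚ.* θ
      e′ .hi = hi e
      e′ .lo≤hi = ≤-difference _ 0≤[1-θ]*gap gap-e′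
      e′ .lower i = ≤-difference _ (q≤p⇒p-q≥0 (lift above 0≤above h i))
        (trans (solve 4 (λ l g y z → z :- (l :+ g) :* y := (z :- l :* y) :- g :* y) refl
            (lo e) (gap e ℚ.* θ) (y (suc k) i) (power m z i))
          (cong (ℚ._- gap e ℚ.* θ ℚ.* y (suc k) i) (sym (power-above m i))))
      e′ .upper = upper-power m

    reduce : ½ ℚ.* (gap e ℚ.* y k Fin.zero) ℚ.≤ below Fin.zero → ∃ Improved
    reduce h = e′
      , ℚₚ.≤-refl
      , ≤-difference _ 0≤gap*θ (solve 2 (λ l g → l :- (l :- g) := g) refl (hi e) (gap e ℚ.* θ))
      , gap-e′
      where
      gap-e′ : hi e ℚ.- gap e ℚ.* θ ℚ.- lo e ≡ (1ℚ ℚ.- θ) ℚ.* gap e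
      gap-e′ = solve 3 (λ l h θ → h :- (h :- l) :* θ :- l := (con 1ℚ :- θ) :* (h :- l)) refl (lo e) (hi e) θ
      e′ : Enclosure (suc k) (power m z)
      e′ .lo = lo e
      e′ .hi = hi e ℚ.- gap e ℚ.* θ
      e′ .lo≤hi = ≤-difference _ 0≤[1-θ]*gap gap-e′
      e′ .lower = lower-power m
      e′ .upper i = ≤-difference _ (q≤p⇒p-q≥0 (lift below 0≤below h i))
        (trans (solve 4 (λ h g y z → (h :- g) :* y :- z := (h :* y :- z) :- g :* y) refl
            (hi e) (gap e ℚ.* θ) (y (suc k) i) (power m z i))
          (cong (ℚ._- gap e ℚ.* θ ℚ.* y (suc k) i) (sym (power-below m i))))

    above+below : above Fin.zero ℚ.+ below Fin.zero ≡ gap e ℚ.* y k Fin.zero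
    above+below = solve 4 (λ l h y z →
      ((:- l) :* y :+ con 1ℚ :* z) :+ (h :* y :+ (:- con 1ℚ) :* z) := (h :- l) :* y) refl
      (lo e) (hi e) (y k Fin.zero) (z Fin.zero)

    -- At the base vertex the two distances add up to the gap times the entry of `y k`, so at least
    -- one of them is half of it. Being rational, they can be compared.
    improve : ∃ Improved
    improve with ½ ℚ.* (gap e ℚ.* y k Fin.zero) ℚₚ.≤? above Fin.zero
    ... | yes h = raise h
    ... | no ¬h = reduce (≤-difference _ (q≤p⇒p-q≥0 (ℚₚ.<⇒≤ (ℚₚ.≰⇒> ¬h)))
      (trans (cong (λ s → below Fin.zero ℚ.- ½ ℚ.* s) (sym above+below))
        (trans (solve 2 (λ a b → b :- con ½ :* (a :+ b) := con ½ :* (a :+ b) :- a) refl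
            (above Fin.zero) (below Fin.zero))
          (cong (λ s → ½ ℚ.* s ℚ.- above Fin.zero) above+below))))

  module _ (z : Vector ℚ (suc n)) (0≤z : ∀ i → 0ℚ ℚ.≤ z i) where

    enclosure : ∀ k → Enclosure k (iterate k z)
    enclosure zero .lo = 0ℚ
    enclosure zero .hi = sum z
    enclosure zero .lo≤hi = sum-nonneg 0≤z
    enclosure zero .lower i = subst (ℚ._≤ z i) (sym (ℚₚ.*-zeroˡ 1ℚ)) (0≤z i)
    enclosure zero .upper i = subst (z i ℚ.≤_) (sym (ℚₚ.*-identityʳ (sum z))) (term≤sum 0≤z i)
    enclosure (suc k) = proj₁ (improve k (iterate k z) (enclosure k))

    improved : ∀ k → Improved k (iterate k z) (enclosure k) (enclosure (suc k))
    improved k = proj₂ (improve k (iterate k z) (enclosure k))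

    lo-mono : ∀ d k → lo (enclosure k) ℚ.≤ lo (enclosure (d ℕ.+ k))
    lo-mono zero    k = ℚₚ.≤-refl
    lo-mono (suc d) k = ℚₚ.≤-trans (lo-mono d k) (proj₁ (improved (d ℕ.+ k)))

    hi-mono : ∀ d k → hi (enclosure (d ℕ.+ k)) ℚ.≤ hi (enclosure k)
    hi-mono zero    k = ℚₚ.≤-refl
    hi-mono (suc d) k = ℚₚ.≤-trans (proj₁ (proj₂ (improved (d ℕ.+ k)))) (hi-mono d k)

    -- Bernoulli: (1 - θ)ᵏ (1 + kθ) ≤ 1.
    gap-decay : ∀ k → gap (enclosure k) ℚ.* (1ℚ ℚ.+ ι k ℚ.* θ) ℚ.≤ gap (enclosure 0)
    gap-decay zero = ℚₚ.≤-reflexive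
      (solve 2 (λ g θ → g :* (con 1ℚ :+ con 0ℚ :* θ) := g) refl (gap (enclosure 0)) θ)
    gap-decay (suc k) = ℚₚ.≤-trans (≤-difference
      (gap (enclosure k) ℚ.* (θ ℚ.* θ ℚ.* (1ℚ ℚ.+ ι k)))
      (*-nonneg (0≤gap (enclosure k)) (*-nonneg (square-nonneg θ) (+-nonneg (ℚₚ.<⇒≤ 0<1ℚ) (ι-nonneg k))))
      (trans (cong₂ (λ g s → gap (enclosure k) ℚ.* (1ℚ ℚ.+ ι k ℚ.* θ) ℚ.- g ℚ.* (1ℚ ℚ.+ s ℚ.* θ))
          (proj₂ (proj₂ (improved k))) (ι-suc k))
        (solve 3 (λ g k θ → g :* (con 1ℚ :+ k :* θ) :- (con 1ℚ :- θ) :* g :* (con 1ℚ :+ (con 1ℚ :+ k) :* θ)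
            := g :* (θ :* θ :* (con 1ℚ :+ k))) refl (gap (enclosure k)) (ι k) θ)))
      (gap-decay k)

    gap-small : ∀ ε → 0ℚ ℚ.< ε → Eventually (λ k → gap (enclosure k) ℚ.≤ ε)
    gap-small ε 0<ε =
      -- For s = 1 / (θε) and k ≥ gap₀ · s one has gap₀ ≤ kθε ≤ ε(1 + kθ), and the Bernoulli factor
      -- 1 + kθ of `gap-decay` cancels.
      let s , _ , θεs≡1 = divide-positive (*-positive 0<θ 0<ε) 0<1ℚ
          N , gs≤N = archimedean (gap (enclosure 0) ℚ.* s)
      in N , λ k N≤k → small s θεs≡1 k (ℚₚ.≤-trans gs≤N (ι-mono-≤ N≤k))
      where
      small : ∀ s → θ ℚ.* ε ℚ.* s ≡ 1ℚ → ∀ k → gap (enclosure 0) ℚ.* s ℚ.≤ ι k → gap (enclosure k) ℚ.≤ ε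
      small s θεs≡1 k gs≤k = ℚₚ.*-cancelʳ-≤-pos (1ℚ ℚ.+ ι k ℚ.* θ)
        {{ℚ.positive (ℚₚ.<-≤-trans 0<1ℚ (≤-weaken (*-nonneg (ι-nonneg k) (ℚₚ.<⇒≤ 0<θ)) ℚₚ.≤-refl))}} (begin
        gap (enclosure k) ℚ.* (1ℚ ℚ.+ ι k ℚ.* θ)      ≤⟨ gap-decay k ⟩
        gap (enclosure 0)                             ≡⟨ ℚₚ.*-identityʳ _ ⟨
        gap (enclosure 0) ℚ.* 1ℚ                      ≡⟨ cong (gap (enclosure 0) ℚ.*_) θεs≡1 ⟨
        gap (enclosure 0) ℚ.* (θ ℚ.* ε ℚ.* s)
          ≡⟨ solve 4 (λ g θ ε s → g :* (θ :* ε :* s) := g :* s :* (θ :* ε)) refl (gap (enclosure 0)) θ ε s ⟩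
        gap (enclosure 0) ℚ.* s ℚ.* (θ ℚ.* ε)
          ≤⟨ *-monoʳ-≤ (θ ℚ.* ε) (ℚₚ.<⇒≤ (*-positive 0<θ 0<ε)) gs≤k ⟩
        ι k ℚ.* (θ ℚ.* ε)
          ≤⟨ ≤-difference ε (ℚₚ.<⇒≤ 0<ε)
               (solve 3 (λ k θ ε → ε :* (con 1ℚ :+ k :* θ) :- k :* (θ :* ε) := ε) refl (ι k) θ ε) ⟩
        ε ℚ.* (1ℚ ℚ.+ ι k ℚ.* θ)                      ∎)
        where open ℚₚ.≤-Reasoning

  -- Limits of the ratios and the eigenvalue equation

  inverse : ∀ k → ∃[ c ] 0ℚ ℚ.< c × y k Fin.zero ℚ.* c ≡ 1ℚ
  inverse k = divide-positive (y-base-positive k) 0<1ℚ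

  c : ℕ → ℚ
  c k = proj₁ (inverse k)

  0≤c : ∀ k → 0ℚ ℚ.≤ c k
  0≤c k = ℚₚ.<⇒≤ (proj₁ (proj₂ (inverse k)))

  y*c : ∀ k → y k Fin.zero ℚ.* c k ≡ 1ℚ
  y*c k = proj₂ (proj₂ (inverse k))

  ratio : Vector ℚ (suc n) → ℕ → ℚ
  ratio z k = iterate k z Fin.zero ℚ.* c k

  cancel-y*c : ∀ p k → p ℚ.* y k Fin.zero ℚ.* c k ≡ p
  cancel-y*c p k = trans (ℚₚ.*-assoc p (y k Fin.zero) (c k)) (trans (cong (p ℚ.*_) (y*c k)) (ℚₚ.*-identityʳ p))

  module _ (z : Vector ℚ (suc n)) (0≤z : ∀ i → 0ℚ ℚ.≤ z i) where

    lo≤ratio : ∀ k → lo (enclosure z 0≤z k) ℚ.≤ ratio z k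
    lo≤ratio k = subst (ℚ._≤ ratio z k) (cancel-y*c (lo (enclosure z 0≤z k)) k)
      (*-monoʳ-≤ (c k) (0≤c k) (lower (enclosure z 0≤z k) Fin.zero))

    ratio≤hi : ∀ k → ratio z k ℚ.≤ hi (enclosure z 0≤z k)
    ratio≤hi k = subst (ratio z k ℚ.≤_) (cancel-y*c (hi (enclosure z 0≤z k)) k)
      (*-monoʳ-≤ (c k) (0≤c k) (upper (enclosure z 0≤z k) Fin.zero))

    lo≤later : ∀ {N k} → N ℕ.≤ k → lo (enclosure z 0≤z N) ℚ.≤ ratio z k
    lo≤later {N} {k} N≤k = ℚₚ.≤-trans
      (subst (λ l → lo (enclosure z 0≤z N) ℚ.≤ lo (enclosure z 0≤z l)) (ℕₚ.m∸n+n≡m N≤k) (lo-mono z 0≤z (k ℕ.∸ N) N))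
      (lo≤ratio k)

    later≤hi : ∀ {N k} → N ℕ.≤ k → ratio z k ℚ.≤ hi (enclosure z 0≤z N)
    later≤hi {N} {k} N≤k = ℚₚ.≤-trans (ratio≤hi k)
      (subst (λ l → hi (enclosure z 0≤z l) ℚ.≤ hi (enclosure z 0≤z N)) (ℕₚ.m∸n+n≡m N≤k) (hi-mono z 0≤z (k ℕ.∸ N) N))

    ratio-cauchy : IsCauchy (ratio z)
    ratio-cauchy ε 0<ε =
      let N , small = gap-small z 0≤z ε 0<ε
      in N , λ k l N≤k N≤l → ℚₚ.≤-trans
           (∣p-q∣≤width (lo≤later N≤k) (later≤hi N≤k) (lo≤later N≤l) (later≤hi N≤l))
           (small N ℕₚ.≤-refl)

    ratio-nonneg : ∀ k → 0ℚ ℚ.≤ ratio z k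
    ratio-nonneg k = *-nonneg (iterate-nonneg k 0≤z Fin.zero) (0≤c k)

    limit : ℝ
    limit = mkℝ (ratio z) ratio-cauchy

  -- If φ = lim `ratio` satisfies φ(Qᵀz) = ρ φ(z), then z = 1 and φ(1) = 1 leave only this value for
  -- ρ.
  eigenvalue : ℝ
  eigenvalue = limit (Qᵀ ones) (Qᵀ-nonneg 0≤ones)

  eigenvector : Vector ℝ (suc n)
  eigenvector i = limit (δ i) (δ-nonneg i)

  ratio-expand : ∀ z k → ratio z k ≡ sum (λ j → z j ℚ.* ratio (δ j) k)
  ratio-expand z k = begin
    iterate k z Fin.zero ℚ.* c k
      ≡⟨ cong (λ u → u Fin.zero ℚ.* c k) (iterate-power k z) ⟩
    power (k ℕ.* m) z Fin.zero ℚ.* c k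
      ≡⟨ cong (ℚ._* c k) (power-expand (k ℕ.* m) z Fin.zero) ⟩
    sum (λ j → z j ℚ.* power (k ℕ.* m) (δ j) Fin.zero) ℚ.* c k
      ≡⟨ *-distribʳ-sum (c k) (λ j → z j ℚ.* power (k ℕ.* m) (δ j) Fin.zero) ⟩
    sum (λ j → z j ℚ.* power (k ℕ.* m) (δ j) Fin.zero ℚ.* c k)
      ≡⟨ sum-cong-≗ (λ j → trans (ℚₚ.*-assoc (z j) (power (k ℕ.* m) (δ j) Fin.zero) (c k))
           (cong (λ u → z j ℚ.* (u Fin.zero ℚ.* c k)) (sym (iterate-power k (δ j))))) ⟩
    sum (λ j → z j ℚ.* ratio (δ j) k) ∎
    where open ≡-Reasoning

  iterate-Qᵀ : ∀ k z → iterate k (Qᵀ z) ≡ Qᵀ (iterate k z)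
  iterate-Qᵀ k z = trans (iterate-power k (Qᵀ z))
    (trans (power-Qᵀ (k ℕ.* m) z) (cong Qᵀ (sym (iterate-power k z))))

  -- The ratio of `ones` is exactly 1 at every `k`, so the entries always add up to 1 and the limit
  -- vector cannot vanish.
  eigenvector-sum : sumᴿ eigenvector ≈ fromℕ 1
  eigenvector-sum = pointwise-≈ {sumᴿ eigenvector} {fromℕ 1} λ k →
    trans (seq-sumᴿ eigenvector k)
      (trans (sum-cong-≗ λ j → sym (ℚₚ.*-identityˡ (ratio (δ j) k)))
        (trans (sym (ratio-expand ones k)) (y*c k)))

  -- Here the transpose is undone: `Qᵀ (δ i)` is row `i` of `Q`, and `ratio` is linear at every `k`,
  -- before any limit is taken.
  seq-*ʳ-eigenvector : ∀ i k → seq ((Q *ʳ eigenvector) i) k ≡ ratio (Qᵀ (δ i)) k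
  seq-*ʳ-eigenvector i k = trans (seq-sumᴿ (λ j → fromℕ (Q i j) * eigenvector j) k)
    (trans (sum-cong-≗ λ j → cong (ℚ._* ratio (δ j) k) (sym (Qᵀ-δ i j)))
      (sym (ratio-expand (Qᵀ (δ i)) k)))

  -- Applying Qᵀ to an enclosure of iterate k (δ i) yields the same bounds for
  -- both sides, relative to the eigenvalue approximation t.
  eigen-error : ∀ i k → ℚ.∣ ratio (Qᵀ (δ i)) k ℚ.- ratio (δ i) k ℚ.* ratio (Qᵀ ones) k ∣ ℚ.≤
    ratio (Qᵀ ones) k ℚ.* gap (enclosure (δ i) (δ-nonneg i) k)
  eigen-error i k = ℚₚ.≤-trans
    (∣p-q∣≤width {a = lo e ℚ.* t} {b = hi e ℚ.* t}
      (subst (lo e ℚ.* t ℚ.≤_) (sym Qᵀ-ratio) (subst (ℚ._≤ Qᵀ u Fin.zero ℚ.* c k) (sym (scaled (lo e)))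
        (*-monoʳ-≤ (c k) (0≤c k) (lower-power k u e 1 Fin.zero))))
      (subst (ℚ._≤ hi e ℚ.* t) (sym Qᵀ-ratio) (subst (Qᵀ u Fin.zero ℚ.* c k ℚ.≤_) (sym (scaled (hi e)))
        (*-monoʳ-≤ (c k) (0≤c k) (upper-power k u e 1 Fin.zero))))
      (*-monoʳ-≤ t 0≤t (lo≤ratio (δ i) (δ-nonneg i) k))
      (*-monoʳ-≤ t 0≤t (ratio≤hi (δ i) (δ-nonneg i) k)))
    (ℚₚ.≤-reflexive (solve 3 (λ l h t → h :* t :- l :* t := t :* (h :- l)) refl (lo e) (hi e) t))
    where
    u : Vector ℚ (suc n)
    u = iterate k (δ i)

    e : Enclosure k u
    e = enclosure (δ i) (δ-nonneg i) k

    t : ℚ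
    t = ratio (Qᵀ ones) k

    0≤t : 0ℚ ℚ.≤ t
    0≤t = ratio-nonneg (Qᵀ ones) (Qᵀ-nonneg 0≤ones) k

    Qᵀ-ratio : ratio (Qᵀ (δ i)) k ≡ Qᵀ u Fin.zero ℚ.* c k
    Qᵀ-ratio = cong (λ w → w Fin.zero ℚ.* c k) (iterate-Qᵀ k (δ i))

    scaled : ∀ p → p ℚ.* t ≡ p ℚ.* Qᵀ (y k) Fin.zero ℚ.* c k
    scaled p = trans (cong (λ w → p ℚ.* (w Fin.zero ℚ.* c k)) (iterate-Qᵀ k ones))
      (sym (ℚₚ.*-assoc p (Qᵀ (y k) Fin.zero) (c k)))

  eigen-equation : ∀ i → (Q *ʳ eigenvector) i ≈ eigenvector i * eigenvalue
  eigen-equation i ε 0<ε =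
    let B , 0<B , bounded = eventually-bounded eigenvalue
        η , 0<η , Bη≡ε = divide-positive 0<B 0<ε
    in eventually-zip (λ k t≤B gap≤η → begin
         ℚ.∣ seq ((Q *ʳ eigenvector) i) k ℚ.- ratio (δ i) k ℚ.* ratio (Qᵀ ones) k ∣
           ≡⟨ cong (λ p → ℚ.∣ p ℚ.- ratio (δ i) k ℚ.* ratio (Qᵀ ones) k ∣) (seq-*ʳ-eigenvector i k) ⟩
         ℚ.∣ ratio (Qᵀ (δ i)) k ℚ.- ratio (δ i) k ℚ.* ratio (Qᵀ ones) k ∣
           ≤⟨ eigen-error i k ⟩
         ratio (Qᵀ ones) k ℚ.* gap (enclosure (δ i) (δ-nonneg i) k)
           ≤⟨ *-monoʳ-≤ _ (0≤gap (enclosure (δ i) (δ-nonneg i) k))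
                (ℚₚ.≤-trans (p≤∣p∣ (ratio (Qᵀ ones) k)) t≤B) ⟩
         B ℚ.* gap (enclosure (δ i) (δ-nonneg i) k)
           ≤⟨ *-monoˡ-≤ B (ℚₚ.<⇒≤ 0<B) gap≤η ⟩
         B ℚ.* η
           ≡⟨ Bη≡ε ⟩
         ε ∎) bounded (gap-small (δ i) (δ-nonneg i) η 0<η)
    where open ℚₚ.≤-Reasoning

  ¬eigenvector≤0 : ¬ (∀ i → eigenvector i ≤ 0ℝ)
  ¬eigenvector≤0 v≤0 = <⇒≱ {0ℝ} {fromℕ 1} (fromℕ-positive {1} ℕₚ.≤-refl)
    (≤-trans {fromℕ 1} {sumᴿ eigenvector} {0ℝ} (≈⇒≥ {sumᴿ eigenvector} {fromℕ 1} eigenvector-sum)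
      (≤-trans {sumᴿ eigenvector} {sumᴿ {suc n} (λ _ → 0ℝ)} {0ℝ}
        (sumᴿ-mono-≤ {suc n} {eigenvector} {λ _ → 0ℝ} v≤0)
        (pointwise-≤ {sumᴿ {suc n} (λ _ → 0ℝ)} {0ℝ} λ k → ℚₚ.≤-reflexive
          (trans (seq-sumᴿ {suc n} (λ _ → 0ℝ) k) (sum-zero {suc n} (λ _ → refl))))))

-- The existence part of Perron-Frobenius. The positive diagonal makes the irreducible matrix
-- primitive; for a periodic matrix the ratios could oscillate.
perron : ∀ {n} (Q : Matrix ℕ (suc n)) → Irreducible Q → (∀ i → 1 ℕ.≤ Q i i) →
  ∃[ ρ ] Σ[ v ∈ Vector ℝ (suc n) ] (0ℝ ≤ ρ) × (∀ i → 0ℝ ≤ v i) × ¬ (∀ i → v i ≤ 0ℝ) ×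
    (∀ i → (Q *ʳ v) i ≈ v i * ρ)
perron {n} Q irreducible 1≤diagonal =
  let C , 1≤C , grows = growth-bound m
      0<C = ℚₚ.<-≤-trans 0<1ℚ 1≤C
      θ , 0<θ , θ-small = divide-positive
        (*-positive 0<C (*-positive 0<C (ι-positive {suc n} (ℕ.s≤s ℕ.z≤n)))) (ℚₚ.positive⁻¹ ½)
  in packed C 1≤C grows θ 0<θ θ-small
  where
  open Transpose Q

  to from : Fin (suc n) → ℕ
  from i = length (irreducible Fin.zero i)
  to   i = length (irreducible i Fin.zero)

  m : ℕ
  -- A sum is at least each of its terms, so `m` steps suffice for every chosen walk from or to the
  -- base vertex.
  m = sumℕ (λ i → from i ℕ.+ to i)

  from-base : ∀ z → (∀ i → 0ℚ ℚ.≤ z i) → ∀ i → z Fin.zero ℚ.≤ power m z i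
  from-base z 0≤z i = reach-≤ 1≤diagonal 0≤z (irreducible Fin.zero i)
    (ℕₚ.≤-trans (ℕₚ.m≤m+n (from i) (to i)) (entry≤sum (λ i → from i ℕ.+ to i) i))

  to-base : ∀ z → (∀ i → 0ℚ ℚ.≤ z i) → ∀ i → z i ℚ.≤ power m z Fin.zero
  to-base z 0≤z i = reach-≤ 1≤diagonal 0≤z (irreducible i Fin.zero)
    (ℕₚ.≤-trans (ℕₚ.m≤n+m (to i) (from i)) (entry≤sum (λ i → from i ℕ.+ to i) i))

  packed : ∀ C → 1ℚ ℚ.≤ C → (∀ z → (∀ i → 0ℚ ℚ.≤ z i) → sum (power m z) ℚ.≤ C ℚ.* sum z) →
    ∀ θ → 0ℚ ℚ.< θ → C ℚ.* (C ℚ.* ι (suc n)) ℚ.* θ ≡ ½ →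
    ∃[ ρ ] Σ[ v ∈ Vector ℝ (suc n) ] (0ℝ ≤ ρ) × (∀ i → 0ℝ ≤ v i) × ¬ (∀ i → v i ≤ 0ℝ) ×
      (∀ i → (Q *ʳ v) i ≈ v i * ρ)
  packed C 1≤C grows θ 0<θ θ-small =
      eigenvalue , eigenvector
    , pointwise-≤ {0ℝ} {eigenvalue} (ratio-nonneg (Qᵀ ones) (Qᵀ-nonneg 0≤ones))
    , (λ i → pointwise-≤ {0ℝ} {eigenvector i} (ratio-nonneg (δ i) (δ-nonneg i)))
    , ¬eigenvector≤0 , eigen-equation
    where open PowerIteration Q m from-base to-base C 1≤C grows θ 0<θ θ-small

-- Bounds on the spectral radius

real-isEigenvalue : ∀ {n} (Q : Matrix ℕ n) ρ (v : Vector ℝ n) → ¬ (∀ i → v i ≤ 0ℝ) →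
  (∀ i → (Q *ʳ v) i ≈ v i * ρ) → IsEigenvalue (λ i j → fromℕᶜ (Q i j)) (ρ +i 0ℝ)
real-isEigenvalue {n} Q ρ v ¬v≤0 eigen = w , nonzero , λ i → re-equation i , im-equation i
  where
  w : Vector ℂ n
  w i = v i +i 0ℝ

  nonzero : ¬ (∀ i → w i ≈ᶜ 0ᶜ)
  nonzero w≈0 = ¬v≤0 (λ i → ≈⇒≤ {v i} {0ℝ} (proj₁ (w≈0 i)))

  re-equation : ∀ i → re (((λ i j → fromℕᶜ (Q i j)) *ᵛ w) i) ≈ re ((ρ +i 0ℝ) *ᶜ w i)
  re-equation i = ≈-trans {re (((λ i j → fromℕᶜ (Q i j)) *ᵛ w) i)} {(Q *ʳ v) i} {re ((ρ +i 0ℝ) *ᶜ w i)}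
    (pointwise-≈ {re (((λ i j → fromℕᶜ (Q i j)) *ᵛ w) i)} {(Q *ʳ v) i} λ k →
      trans (seq-re-*ᵛ Q w i k) (sym (seq-sumᴿ (λ j → fromℕ (Q i j) * v j) k)))
    (≈-trans {(Q *ʳ v) i} {v i * ρ} {re ((ρ +i 0ℝ) *ᶜ w i)} (eigen i)
      (pointwise-≈ {v i * ρ} {re ((ρ +i 0ℝ) *ᶜ w i)} λ k →
        solve 2 (λ v ρ → v :* ρ := ρ :* v :- con 0ℚ :* con 0ℚ) refl (seq (v i) k) (seq ρ k)))

  im-equation : ∀ i → im (((λ i j → fromℕᶜ (Q i j)) *ᵛ w) i) ≈ im ((ρ +i 0ℝ) *ᶜ w i)
  im-equation i = pointwise-≈ {im (((λ i j → fromℕᶜ (Q i j)) *ᵛ w) i)} {im ((ρ +i 0ℝ) *ᶜ w i)} λ k →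
    trans (seq-im-*ᵛ Q w i k) (trans (sum-zero (λ j → ℚₚ.*-zeroʳ (ι (Q i j))))
      (solve 2 (λ v ρ → con 0ℚ := ρ :* con 0ℚ :+ con 0ℚ :* v) refl (seq (v i) k) (seq ρ k)))

real-isModulus : ∀ ρ → 0ℝ ≤ ρ → IsModulus ρ (ρ +i 0ℝ)
real-isModulus ρ 0≤ρ = 0≤ρ , pointwise-≈ {ρ * ρ} {ρ * ρ + 0ℝ * 0ℝ} λ k →
  solve 1 (λ ρ → ρ :* ρ := ρ :* ρ :+ con 0ℚ :* con 0ℚ) refl (seq ρ k)

module SpectralRadius {n} (Q : Matrix ℕ (suc n)) (irreducible : Irreducible Q)
  (1≤diagonal : ∀ i → 1 ℕ.≤ Q i i) (q : ℝ) where

  1≤rowSum : ∀ i → 1 ℕ.≤ rowSum Q i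
  1≤rowSum i = ℕₚ.≤-trans (1≤diagonal i) (entry≤sum (Q i) i)

  module _ (isRadius : IsSpectralRadius (λ i j → fromℕᶜ (Q i j)) q) (c : ℕ) where

    -- The Perron eigenvalue is nonnegative and so its own modulus, which `q` dominates; a lower
    -- bound for it is one for `q`.
    ≤-radius : (∀ i → c ℕ.≤ rowSum Q i) → fromℕ c ≤ q
    ≤-radius c≤r =
      let ρ , v , 0≤ρ , 0≤v , ¬v≤0 , eigen = perron Q irreducible 1≤diagonal
      in ≤-trans {fromℕ c} {ρ} {q}
           (NonnegativeEigenvector.eigenvalue≥ Q irreducible ρ v 0≤v ¬v≤0 eigen c c≤r)
           (proj₂ isRadius (ρ +i 0ℝ) ρ (real-isEigenvalue Q ρ v ¬v≤0 eigen) (real-isModulus ρ 0≤ρ))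

    ≤-radius-tight : (∀ i → c ℕ.≤ rowSum Q i) → q ≤ fromℕ c → ∀ i → rowSum Q i ℕ.≤ c
    ≤-radius-tight c≤r q≤c =
      let ρ , v , 0≤ρ , 0≤v , ¬v≤0 , eigen = perron Q irreducible 1≤diagonal
      in NonnegativeEigenvector.eigenvalue≤⇒rowSum≤ Q irreducible ρ v 0≤v ¬v≤0 eigen c c≤r
           (≤-trans {ρ} {q} {fromℕ c}
             (proj₂ isRadius (ρ +i 0ℝ) ρ (real-isEigenvalue Q ρ v ¬v≤0 eigen) (real-isModulus ρ 0≤ρ)) q≤c)

    -- Here `q` is used as the modulus of an actual eigenvalue: the squared moduli of its
    -- eigenvector form the vector of `SquaredSubeigenvector`.
    radius-≤ : (∀ i → rowSum Q i ℕ.≤ c) → q ≤ fromℕ c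
    radius-≤ =
      let μ , (v , v≉0 , eigen) , 0≤q , q²≈∣μ∣² = proj₁ isRadius
      in SquaredSubeigenvector.radius≤ Q q 0≤q (λ i → ∣ v i ∣²)
           (λ v≤0 → v≉0 (λ i → ∣∣²≤0⇒≈0 {v i} (v≤0 i)))
           (λ i → eigenvector-subeigenvector Q μ v q q²≈∣μ∣² i (1≤rowSum i) (eigen i)) c

    radius-≤-tight : (∀ i → rowSum Q i ℕ.≤ c) → fromℕ c ≤ q → ∀ i → c ℕ.≤ rowSum Q i
    radius-≤-tight =
      let μ , (v , v≉0 , eigen) , 0≤q , q²≈∣μ∣² = proj₁ isRadius
      in SquaredSubeigenvector.radius≥⇒rowSum≥ Q q 0≤q (λ i → ∣ v i ∣²)
           (λ v≤0 → v≉0 (λ i → ∣∣²≤0⇒≈0 {v i} (v≤0 i)))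
           (λ i → eigenvector-subeigenvector Q μ v q q²≈∣μ∣² i (1≤rowSum i) (eigen i)) c irreducible

-- Digraphs

sumℕ-cong : ∀ {n} {f g : Vector ℕ n} → (∀ i → f i ≡ g i) → sumℕ f ≡ sumℕ g
sumℕ-cong {zero}  f≡g = refl
sumℕ-cong {suc n} f≡g = cong₂ ℕ._+_ (f≡g Fin.zero) (sumℕ-cong (f≡g ∘ Fin.suc))

sumℕ-mono-≤ : ∀ {n} {f g : Vector ℕ n} → (∀ i → f i ℕ.≤ g i) → sumℕ f ℕ.≤ sumℕ g
sumℕ-mono-≤ {zero}  f≤g = ℕ.z≤n
sumℕ-mono-≤ {suc n} f≤g = ℕₚ.+-mono-≤ (f≤g Fin.zero) (sumℕ-mono-≤ (f≤g ∘ Fin.suc))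

sumℕ-mono-< : ∀ {n} {f g : Vector ℕ n} → (∀ i → f i ℕ.≤ g i) → ∀ i → f i ℕ.< g i → sumℕ f ℕ.< sumℕ g
sumℕ-mono-< f≤g Fin.zero    f<g = ℕₚ.+-mono-<-≤ f<g (sumℕ-mono-≤ (f≤g ∘ Fin.suc))
sumℕ-mono-< f≤g (Fin.suc i) f<g = ℕₚ.+-mono-≤-< (f≤g Fin.zero) (sumℕ-mono-< (f≤g ∘ Fin.suc) i f<g)

sumℕ-distrib-+ : ∀ {n} (f g : Vector ℕ n) → sumℕ (λ i → f i ℕ.+ g i) ≡ sumℕ f ℕ.+ sumℕ g
sumℕ-distrib-+ {zero}  f g = refl
sumℕ-distrib-+ {suc n} f g = trans
  (cong (f Fin.zero ℕ.+ g Fin.zero ℕ.+_) (sumℕ-distrib-+ (f ∘ Fin.suc) (g ∘ Fin.suc)))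
  (interchange (f Fin.zero) (g Fin.zero) (sumℕ (f ∘ Fin.suc)) (sumℕ (g ∘ Fin.suc)))
  where open CommutativeSemigroupProperties ℕₚ.+-commutativeSemigroup using (interchange)

sumℕ-zero : ∀ {n} {f : Vector ℕ n} → (∀ i → f i ≡ 0) → sumℕ f ≡ 0
sumℕ-zero {zero}  f≡0 = refl
sumℕ-zero {suc n} f≡0 = cong₂ ℕ._+_ (f≡0 Fin.zero) (sumℕ-zero (f≡0 ∘ Fin.suc))

sumℕ-one : ∀ n → sumℕ {n} (λ _ → 1) ≡ n
sumℕ-one zero    = refl
sumℕ-one (suc n) = cong suc (sumℕ-one n)

sumℕ-single : ∀ {n} (f : Vector ℕ n) i → (∀ j → i ≢ j → f j ≡ 0) → sumℕ f ≡ f i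
sumℕ-single f Fin.zero    f≡0 = trans
  (cong (f Fin.zero ℕ.+_) (sumℕ-zero (λ j → f≡0 (Fin.suc j) λ ())))
  (ℕₚ.+-identityʳ (f Fin.zero))
sumℕ-single f (Fin.suc i) f≡0 = cong₂ ℕ._+_ (f≡0 Fin.zero λ ())
  (sumℕ-single (f ∘ Fin.suc) i λ j i≢j → f≡0 (Fin.suc j) (i≢j ∘ Finₚ.suc-injective))

two-entries≤sum : ∀ {n} (f : Vector ℕ n) {i j} → i ≢ j → f i ℕ.+ f j ℕ.≤ sumℕ f
two-entries≤sum f {Fin.zero}  {Fin.zero}  i≢j = contradiction refl i≢j
two-entries≤sum f {Fin.zero}  {Fin.suc j} i≢j = ℕₚ.+-monoʳ-≤ (f Fin.zero) (entry≤sum (f ∘ Fin.suc) j)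
two-entries≤sum f {Fin.suc i} {Fin.zero}  i≢j = ℕₚ.≤-trans
  (ℕₚ.≤-reflexive (ℕₚ.+-comm (f (Fin.suc i)) (f Fin.zero)))
  (ℕₚ.+-monoʳ-≤ (f Fin.zero) (entry≤sum (f ∘ Fin.suc) i))
two-entries≤sum f {Fin.suc i} {Fin.suc j} i≢j = ℕₚ.≤-trans
  (two-entries≤sum (f ∘ Fin.suc) (i≢j ∘ cong Fin.suc)) (ℕₚ.m≤n+m _ (f Fin.zero))

∣tabulate∣ : ∀ {n} (f : Fin n → Bool) → ∣ tabulate f ∣ ≡ sumℕ (λ i → if f i then 1 else 0)
∣tabulate∣ {zero}  f = refl
∣tabulate∣ {suc n} f with f Fin.zero
... | true  = cong suc (∣tabulate∣ (f ∘ Fin.suc))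
... | false = ∣tabulate∣ (f ∘ Fin.suc)

diagonal-≡ : ∀ {n} (d : Vector ℕ n) i → diagonal d i i ≡ d i
diagonal-≡ d i with i Finₚ.≟ i
... | yes _  = refl
... | no i≢i = contradiction refl i≢i

diagonal-≢ : ∀ {n} (d : Vector ℕ n) {i j} → i ≢ j → diagonal d i j ≡ 0
diagonal-≢ d {i} {j} i≢j with i Finₚ.≟ j
... | yes i≡j = contradiction i≡j i≢j
... | no _    = refl

rowSum-diagonal : ∀ {n} (d : Vector ℕ n) i → rowSum (diagonal d) i ≡ d i
rowSum-diagonal d i = trans (sumℕ-single (diagonal d i) i (λ j → diagonal-≢ d)) (diagonal-≡ d i)

T-ext : ∀ {a b} → (T a → T b) → (T b → T a) → a ≡ b
T-ext {false} {false} _ _ = refl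
T-ext {false} {true}  _ g = contradiction (g _) id
T-ext {true}  {false} f _ = contradiction (f _) id
T-ext {true}  {true}  _ _ = refl

to-injective : ∀ {n} (f : Fin n ↔ Fin n) {i j} → Inverse.to f i ≡ Inverse.to f j → i ≡ j
to-injective f {i} {j} eq = trans (sym (Inverse.strictlyInverseʳ f i))
  (trans (cong (Inverse.from f) eq) (Inverse.strictlyInverseʳ f j))

module _ {n} (D : Digraph n) where

  outdegree≡rowSum : ∀ i → outdegree D i ≡ rowSum (adjacency D) i
  outdegree≡rowSum i = ∣tabulate∣ (arc D i)

  rowSum-signlessLaplacian : ∀ i → rowSum (signlessLaplacian D) i ≡ 2 ℕ.* outdegree D i
  rowSum-signlessLaplacian i = trans
    (sumℕ-distrib-+ (diagonal (outdegree D) i) (adjacency D i))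
    (cong₂ ℕ._+_ (rowSum-diagonal (outdegree D) i)
      (trans (sym (outdegree≡rowSum i)) (sym (ℕₚ.+-identityʳ (outdegree D i)))))

  arc⇒adjacency : ∀ {i j} → Arc D i j → adjacency D i j ≡ 1
  arc⇒adjacency {i} {j} e with arc D i j
  ... | true = refl

  ¬arc⇒adjacency : ∀ {i j} → ¬ Arc D i j → adjacency D i j ≡ 0
  ¬arc⇒adjacency {i} {j} ¬e with arc D i j
  ... | true  = contradiction _ ¬e
  ... | false = refl

  arc⇒1≤outdegree : ∀ {i j} → Arc D i j → 1 ℕ.≤ outdegree D i
  arc⇒1≤outdegree {i} {j} e = ℕₚ.≤-trans (ℕₚ.≤-reflexive (sym (arc⇒adjacency e)))
    (ℕₚ.≤-trans (entry≤sum (adjacency D i) j) (ℕₚ.≤-reflexive (sym (outdegree≡rowSum i))))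

  no-loop : ∀ {i} → ¬ Arc D i i
  no-loop {i} e = subst T (loopless D i) e

  -- Adding the identity turns the row sums n - 1 of a complete digraph into n, so
  -- that no subtraction is needed.
  reflexive : Matrix ℕ n
  reflexive i j = diagonal (λ _ → 1) i j ℕ.+ adjacency D i j

  rowSum-reflexive : ∀ i → rowSum reflexive i ≡ suc (outdegree D i)
  rowSum-reflexive i = trans (sumℕ-distrib-+ (diagonal (λ _ → 1) i) (adjacency D i))
    (cong₂ ℕ._+_ (rowSum-diagonal (λ _ → 1) i) (sym (outdegree≡rowSum i)))

  adjacency≤1 : ∀ i j → adjacency D i j ℕ.≤ 1
  adjacency≤1 i j with arc D i j
  ... | true  = ℕₚ.≤-refl
  ... | false = ℕ.z≤n

  reflexive≤1 : ∀ i j → reflexive i j ℕ.≤ 1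
  reflexive≤1 i j with i Finₚ.≟ j
  ... | yes refl = ℕₚ.≤-reflexive (cong suc (¬arc⇒adjacency (no-loop {i})))
  ... | no _     = adjacency≤1 i j

  outdegree<n : ∀ i → outdegree D i ℕ.< n
  outdegree<n i = begin
    suc (outdegree D i)   ≡⟨ rowSum-reflexive i ⟨
    rowSum reflexive i    ≤⟨ sumℕ-mono-≤ (reflexive≤1 i) ⟩
    sumℕ {n} (λ _ → 1)    ≡⟨ sumℕ-one n ⟩
    n                     ∎
    where open ℕₚ.≤-Reasoning

  -- A missing arc is a zero in row `i` of `reflexive`, whose entries are at most 1, so the row sum
  -- would fall below `n`.
  full-outdegree⇒arc : ∀ {i} → n ℕ.≤ suc (outdegree D i) → ∀ {j} → i ≢ j → Arc D i j
  full-outdegree⇒arc {i} n≤d {j} i≢j with arc D i j in eq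
  ... | true  = _
  ... | false = ℕₚ.<⇒≱ (sumℕ-mono-< (reflexive≤1 i) j
    (ℕₚ.≤-reflexive (cong suc (cong₂ ℕ._+_ (diagonal-≢ (λ _ → 1) i≢j) (cong (λ b → if b then 1 else 0) eq)))))
    (ℕₚ.≤-trans (ℕₚ.≤-reflexive (sumℕ-one n)) (ℕₚ.≤-trans n≤d (ℕₚ.≤-reflexive (sym (rowSum-reflexive i)))))

  arcs⇒full-outdegree : ∀ {i} → (∀ {j} → i ≢ j → Arc D i j) → n ℕ.≤ suc (outdegree D i)
  arcs⇒full-outdegree {i} arcs = begin
    n                     ≡⟨ sumℕ-one n ⟨
    sumℕ {n} (λ _ → 1)    ≤⟨ sumℕ-mono-≤ 1≤reflexive ⟩
    rowSum reflexive i    ≡⟨ rowSum-reflexive i ⟩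
    suc (outdegree D i)   ∎
    where
    open ℕₚ.≤-Reasoning
    1≤reflexive : ∀ j → 1 ℕ.≤ reflexive i j
    1≤reflexive j with i Finₚ.≟ j
    ... | yes _   = ℕ.s≤s ℕ.z≤n
    ... | no i≢j  = ℕₚ.≤-reflexive (sym (arc⇒adjacency (arcs i≢j)))

  outdegree≤1⇒unique : ∀ {i} → outdegree D i ℕ.≤ 1 → ∀ {j k} → Arc D i j → Arc D i k → j ≡ k
  outdegree≤1⇒unique {i} d≤1 {j} {k} e f with j Finₚ.≟ k
  ... | yes j≡k = j≡k
  ... | no j≢k  = contradiction d≤1 (ℕₚ.<⇒≱ (begin
    2                                      ≡⟨ cong₂ ℕ._+_ (arc⇒adjacency e) (arc⇒adjacency f) ⟨
    adjacency D i j ℕ.+ adjacency D i k    ≤⟨ two-entries≤sum (adjacency D i) j≢k ⟩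
    rowSum (adjacency D) i                 ≡⟨ outdegree≡rowSum i ⟨
    outdegree D i                          ∎))
    where open ℕₚ.≤-Reasoning

  unique⇒outdegree≤1 : ∀ {i j} → Arc D i j → (∀ {k} → Arc D i k → j ≡ k) → outdegree D i ℕ.≤ 1
  unique⇒outdegree≤1 {i} {j} e unique = ℕₚ.≤-reflexive (trans (outdegree≡rowSum i)
    (trans (sumℕ-single (adjacency D i) j (λ k j≢k → ¬arc⇒adjacency (λ f → j≢k (unique f))))
      (arc⇒adjacency e)))

  complete⇒≅ : (∀ {i j} → i ≢ j → Arc D i j) → D ≅ completeDigraph n
  complete⇒≅ arcs = ↔-id (Fin n) , λ i j → T-ext (arc⇒≢ i j) (≢⇒arc i j)
    where
    arc⇒≢ : ∀ i j → Arc D i j → Arc (completeDigraph n) i j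
    arc⇒≢ i j e with i Finₚ.≟ j
    ... | yes refl = contradiction e no-loop
    ... | no _     = _
    ≢⇒arc : ∀ i j → Arc (completeDigraph n) i j → Arc D i j
    ≢⇒arc i j e with i Finₚ.≟ j
    ... | no i≢j = arcs i≢j

  ≅⇒complete : D ≅ completeDigraph n → ∀ {i j} → i ≢ j → Arc D i j
  ≅⇒complete (f , iso) {i} {j} i≢j =
    subst T (sym (iso i j)) (distinct λ eq → i≢j (to-injective f eq))
    where
    distinct : ∀ {i j} → i ≢ j → Arc (completeDigraph n) i j
    distinct {i} {j} i≢j with i Finₚ.≟ j
    ... | yes i≡j = contradiction i≡j i≢j
    ... | no _    = _

-- If `k` were missed, punching it out would inject `suc n` elements into `n`.
injective⇒surjective : ∀ {n} {f : Fin n → Fin n} → (∀ {i j} → f i ≡ f j → i ≡ j) → ∀ k → ∃[ i ] f i ≡ k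
injective⇒surjective {suc n} {f} injective k with Finₚ.any? (λ i → f i Finₚ.≟ k)
... | yes found = found
... | no missed = contradiction
  (Finₚ.injective⇒≤ {f = λ i → Fin.punchOut (λ k≡fi → missed (i , sym k≡fi))}
    (λ {i} {j} eq → injective (Finₚ.punchOut-injective
      (λ k≡fi → missed (i , sym k≡fi)) (λ k≡fj → missed (j , sym k≡fj)) eq)))
  ℕₚ.1+n≰n

-- Directed cycles and digraphs with one out-arc per vertex

module _ {n} (2≤n : 2 ℕ.≤ n) where

  CyclicStep : Fin n → Fin n → Set
  CyclicStep i j = (suc (toℕ i) ≡ toℕ j) ⊎ (suc (toℕ i) ≡ n × toℕ j ≡ 0)

  arc⇒cyclicStep : ∀ {i j} → Arc (directedCycle n 2≤n) i j → CyclicStep i j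
  arc⇒cyclicStep {i} {j} e with Equivalence.to (Boolₚ.T-∨ {suc (toℕ i) ℕ.≡ᵇ toℕ j}) e
  ... | inj₁ p = inj₁ (ℕₚ.≡ᵇ⇒≡ (suc (toℕ i)) (toℕ j) p)
  ... | inj₂ p =
    let u , w = Equivalence.to (Boolₚ.T-∧ {suc (toℕ i) ℕ.≡ᵇ n}) p
    in inj₂ (ℕₚ.≡ᵇ⇒≡ (suc (toℕ i)) n u , ℕₚ.≡ᵇ⇒≡ (toℕ j) 0 w)

  cyclicStep⇒arc : ∀ {i j} → CyclicStep i j → Arc (directedCycle n 2≤n) i j
  cyclicStep⇒arc {i} {j} (inj₁ eq) = Equivalence.from (Boolₚ.T-∨ {suc (toℕ i) ℕ.≡ᵇ toℕ j})
    (inj₁ (ℕₚ.≡⇒≡ᵇ (suc (toℕ i)) (toℕ j) eq))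
  cyclicStep⇒arc {i} {j} (inj₂ (eq , eq′)) = Equivalence.from (Boolₚ.T-∨ {suc (toℕ i) ℕ.≡ᵇ toℕ j})
    (inj₂ (Equivalence.from (Boolₚ.T-∧ {suc (toℕ i) ℕ.≡ᵇ n})
      (ℕₚ.≡⇒≡ᵇ (suc (toℕ i)) n eq , ℕₚ.≡⇒≡ᵇ (toℕ j) 0 eq′)))

  cyclicStep-unique : ∀ {i j k} → CyclicStep i j → CyclicStep i k → j ≡ k
  cyclicStep-unique (inj₁ p) (inj₁ q) = Finₚ.toℕ-injective (trans (sym p) q)
  cyclicStep-unique {j = j} (inj₁ p) (inj₂ (q , _)) =
    contradiction (trans (sym p) q) (ℕₚ.<⇒≢ (Finₚ.toℕ<n j))
  cyclicStep-unique {k = k} (inj₂ (p , _)) (inj₁ q) =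
    contradiction (trans (sym q) p) (ℕₚ.<⇒≢ (Finₚ.toℕ<n k))
  cyclicStep-unique (inj₂ (_ , p)) (inj₂ (_ , q)) = Finₚ.toℕ-injective (trans p (sym q))

  ≅⇒unique : ∀ {D} → D ≅ directedCycle n 2≤n → ∀ {i j k} → Arc D i j → Arc D i k → j ≡ k
  ≅⇒unique (f , iso) {i} {j} {k} e e′ = to-injective f
    (cyclicStep-unique (arc⇒cyclicStep (subst T (iso i j) e)) (arc⇒cyclicStep (subst T (iso i k) e′)))

-- `D` is the graph of the map `next`, so all walks from vertex 0 follow the one sequence `orbit`,
-- which by strong connectivity visits every vertex. The time of a visit is the vertex's label on
-- the cycle.
module FunctionalDigraph {n} (2≤2+n : 2 ℕ.≤ suc (suc n)) (D : Digraph (suc (suc n))) (connected : StronglyConnected D)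
  (next : Fin (suc (suc n)) → Fin (suc (suc n))) (arc-next : ∀ i → Arc D i (next i))
  (next-unique : ∀ {i j} → Arc D i j → next i ≡ j)
  where

  walk : ℕ → Fin (suc (suc n)) → Fin (suc (suc n))
  walk zero    i = i
  walk (suc k) i = next (walk k i)

  walk-next : ∀ k i → walk k (next i) ≡ walk (suc k) i
  walk-next zero    i = refl
  walk-next (suc k) i = cong next (walk-next k i)

  reaches : ∀ {i j} → Star (Arc D) i j → ∃[ k ] walk k i ≡ j
  reaches Star.ε = 0 , refl
  reaches {i} (e ◅ es) =
    let k , eq = reaches es
    in suc k , trans (sym (walk-next k i)) (trans (cong (walk k) (next-unique e)) eq)

  orbit : ℕ → Fin (suc (suc n))
  orbit k = walk k Fin.zero

  period : ∃[ a ] ∃[ b ] a ℕ.< b × b ℕ.≤ suc (suc n) × orbit a ≡ orbit b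
  period =
    let i , j , i<j , eq = Finₚ.pigeonhole (ℕₚ.n<1+n (suc (suc n))) (λ (k : Fin (suc (suc (suc n)))) → orbit (toℕ k))
    in toℕ i , toℕ j , i<j , Finₚ.toℕ≤pred[n] j , eq

  -- Times are kept below the `b` of `period`: when a step would reach `b`, it is replaced by the
  -- earlier time `a` with the same vertex.
  orbit-bounded : ∀ k → ∃[ l ] l ℕ.< suc (suc n) × orbit l ≡ orbit k
  orbit-bounded k =
    let a , b , a<b , b≤n , eq = period
        l , l<b , eq′ = reduce a<b eq k
    in l , ℕₚ.<-≤-trans l<b b≤n , eq′
    where
    reduce : ∀ {a b} → a ℕ.< b → orbit a ≡ orbit b → ∀ k → ∃[ l ] l ℕ.< b × orbit l ≡ orbit k
    reduce a<b eq zero = 0 , ℕₚ.≤-<-trans ℕ.z≤n a<b , refl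
    reduce {a} {b} a<b eq (suc k) =
      let l , l<b , eq′ = reduce a<b eq k
      in [ (λ 1+l<b → suc l , 1+l<b , cong next eq′)
         , (λ 1+l≡b → a , a<b , trans eq (trans (cong orbit (sym 1+l≡b)) (cong next eq′))) ]′
         (ℕₚ.m≤n⇒m<n∨m≡n l<b)

  position : ∀ j → ∃[ k ] orbit (toℕ {suc (suc n)} k) ≡ j
  position j =
    let k , eq = reaches (connected Fin.zero j)
        l , l<n , eq′ = orbit-bounded k
    in Fin.fromℕ< l<n , trans (cong orbit (Finₚ.toℕ-fromℕ< l<n)) (trans eq′ eq)

  index : Fin (suc (suc n)) → Fin (suc (suc n))
  index j = proj₁ (position j)

  orbit-index : ∀ j → orbit (toℕ (index j)) ≡ j
  orbit-index j = proj₂ (position j)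

  -- `orbit-index` makes `index` injective, hence surjective on a finite set, and so its one-sided
  -- inverse is two-sided.
  index-orbit : ∀ k → index (orbit (toℕ k)) ≡ k
  index-orbit k =
    let j , eq = injective⇒surjective {f = index} index-injective k
    in trans (cong index (trans (cong (orbit ∘ toℕ) (sym eq)) (orbit-index j))) eq
    where
    index-injective : ∀ {i j} → index i ≡ index j → i ≡ j
    index-injective {i} {j} eq = trans (sym (orbit-index i)) (trans (cong (orbit ∘ toℕ) eq) (orbit-index j))

  toℕ-index-orbit : ∀ {k} → k ℕ.< suc (suc n) → toℕ (index (orbit k)) ≡ k
  toℕ-index-orbit {k} k<n = trans
    (cong toℕ (trans (cong (index ∘ orbit) (sym (Finₚ.toℕ-fromℕ< k<n))) (index-orbit (Fin.fromℕ< k<n))))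
    (Finₚ.toℕ-fromℕ< k<n)

  -- A walk from vertex 1 to vertex 0 has positive length, and its last arc supplies the
  -- predecessor.
  base-has-predecessor : ∃[ i ] next i ≡ Fin.zero
  base-has-predecessor with reaches (connected (Fin.suc Fin.zero) Fin.zero)
  ... | suc k , eq = walk k (Fin.suc Fin.zero) , eq

  -- Let `k` be the label of a predecessor of vertex 0. The orbit is at vertex 0 at time k + 1; if
  -- that time were below the number of vertices, vertex 0 would carry the label k + 1 besides 0. So
  -- k + 1 is the number of vertices.
  orbit-closes : orbit (suc (suc n)) ≡ Fin.zero
  orbit-closes =
    let i , next-i≡0 = base-has-predecessor
        returns = trans (cong next (orbit-index i)) next-i≡0
    in [ (λ 1+k<n → contradiction
           (trans (sym (toℕ-index-orbit 1+k<n)) (trans (cong (toℕ ∘ index) returns) (toℕ-index-orbit (ℕ.s≤s ℕ.z≤n))))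
           λ ())
       , (λ 1+k≡n → trans (cong orbit (sym 1+k≡n)) returns) ]′
       (ℕₚ.m≤n⇒m<n∨m≡n (Finₚ.toℕ<n (index i)))

  arc⇒step : ∀ {i j} → Arc D i j → CyclicStep 2≤2+n (index i) (index j)
  arc⇒step {i} {j} e = [ (λ 1+k<n → inj₁ (trans (sym (toℕ-index-orbit 1+k<n)) (cong (toℕ ∘ index) next-orbit)))
    , (λ 1+k≡n → inj₂ (1+k≡n , trans
        (cong (toℕ ∘ index) (trans (sym next-orbit) (trans (cong orbit 1+k≡n) orbit-closes)))
        (toℕ-index-orbit {0} (ℕ.s≤s ℕ.z≤n)))) ]′
    (ℕₚ.m≤n⇒m<n∨m≡n (Finₚ.toℕ<n (index i)))
    where
    next-orbit : orbit (suc (toℕ (index i))) ≡ j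
    next-orbit = trans (cong next (orbit-index i)) (next-unique e)

  step⇒arc : ∀ {i j} → CyclicStep 2≤2+n (index i) (index j) → Arc D i j
  step⇒arc {i} {j} s = subst (Arc D i) (next≡j s) (arc-next i)
    where
    next≡j : CyclicStep 2≤2+n (index i) (index j) → next i ≡ j
    next≡j (inj₁ eq) = trans (cong next (sym (orbit-index i))) (trans (cong orbit eq) (orbit-index j))
    next≡j (inj₂ (eq , eq′)) = trans (cong next (sym (orbit-index i)))
      (trans (cong orbit eq) (trans orbit-closes (trans (cong orbit (sym eq′)) (orbit-index j))))

  ≅-directedCycle : D ≅ directedCycle (suc (suc n)) 2≤2+n
  ≅-directedCycle = mk↔ₛ′ index (orbit ∘ toℕ) index-orbit orbit-index , λ i j →
    T-ext (λ e → cyclicStep⇒arc 2≤2+n (arc⇒step e)) (λ e → step⇒arc (arc⇒cyclicStep 2≤2+n e))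

-- There is a second vertex, and the walk to it begins with an arc from `i`. Positive outdegrees in
-- turn give the signless Laplacian its positive diagonal.
out-arc : ∀ {n} {D : Digraph (suc (suc n))} → StronglyConnected D → ∀ i → ∃ (Arc D i)
out-arc {n} {D} connected i = let j , i≢j = another i in first-arc i≢j (connected i j)
  where
  another : ∀ (i : Fin (suc (suc n))) → ∃[ j ] i ≢ j
  another Fin.zero    = Fin.suc Fin.zero , λ ()
  another (Fin.suc _) = Fin.zero , λ ()

  first-arc : ∀ {i j} → i ≢ j → Star (Arc D) i j → ∃ (Arc D i)
  first-arc i≢j Star.ε  = contradiction refl i≢j
  first-arc i≢j (e ◅ _) = _ , e

corollary2p6 : (n : ℕ) (2≤n : 2 ℕ.≤ n) (D : Digraph n) → StronglyConnected D →
    (q : ℝ) → IsSignlessLaplacianRadius D q →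
    (fromℕ 2 ≤ q) × (q ≤ fromℕ (2 ℕ.* (n ℕ.∸ 1))) ×
    ((q ≈ fromℕ (2 ℕ.* n ℕ.∸ 2)) ⇔ (D ≅ completeDigraph n)) ×
    ((q ≈ fromℕ 2) ⇔ (D ≅ directedCycle n 2≤n))
corollary2p6 (suc zero) (ℕ.s≤s ())
corollary2p6 (suc (suc n)) 2≤n D connected q isRadius =
    ≤-radius isRadius 2 2≤rowSum
  , radius-≤ isRadius top rowSum≤top
  , mk⇔ (λ q≈ → complete⇒≅ D (λ {i} → full-outdegree⇒arc D (full i (≈⇒≥ {q} {fromℕ top′} q≈))))
        (λ iso → ≤-antisym {q} {fromℕ top′}
          (subst (λ c → q ≤ fromℕ c) (sym top′≡top) (radius-≤ isRadius top rowSum≤top))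
          (≤-radius isRadius top′ (λ i → top′≤rowSum i (arcs⇒full-outdegree D (≅⇒complete D iso)))))
  , mk⇔ (λ q≈ → cycle (λ i → single i (≈⇒≤ {q} {fromℕ 2} q≈)))
        (λ iso → ≤-antisym {q} {fromℕ 2}
          (radius-≤ isRadius 2 (λ i → rowSum≤2 i (unique⇒outdegree≤1 D (arc-next i)
            (≅⇒unique 2≤n {D} iso (arc-next i)))))
          (≤-radius isRadius 2 2≤rowSum))
  where
  next : Fin (suc (suc n)) → Fin (suc (suc n))
  next i = proj₁ (out-arc {D = D} connected i)

  arc-next : ∀ i → Arc D i (next i)
  arc-next i = proj₂ (out-arc {D = D} connected i)

  1≤outdegree : ∀ i → 1 ℕ.≤ outdegree D i
  1≤outdegree i = arc⇒1≤outdegree D (arc-next i)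

  1≤diagonal : ∀ i → 1 ℕ.≤ signlessLaplacian D i i
  1≤diagonal i = ℕₚ.≤-trans
    (ℕₚ.≤-trans (1≤outdegree i) (ℕₚ.≤-reflexive (sym (diagonal-≡ (outdegree D) i)))) (ℕₚ.m≤m+n (diagonal (outdegree D) i i) (adjacency D i i))

  irreducible : Irreducible (signlessLaplacian D)
  irreducible i j = Star.map (λ {i} {j} e →
    ℕₚ.≤-trans (ℕₚ.≤-reflexive (sym (arc⇒adjacency D e))) (ℕₚ.m≤n+m (adjacency D i j) (diagonal (outdegree D) i j)))
    (connected i j)

  open SpectralRadius (signlessLaplacian D) irreducible 1≤diagonal q

  2d : ∀ i → rowSum (signlessLaplacian D) i ≡ 2 ℕ.* outdegree D i
  2d = rowSum-signlessLaplacian D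

  2≤rowSum : ∀ i → 2 ℕ.≤ rowSum (signlessLaplacian D) i
  2≤rowSum i = subst (2 ℕ.≤_) (sym (2d i)) (ℕₚ.*-monoʳ-≤ 2 (1≤outdegree i))

  rowSum≤2 : ∀ i → outdegree D i ℕ.≤ 1 → rowSum (signlessLaplacian D) i ℕ.≤ 2
  rowSum≤2 i d≤1 = subst (ℕ._≤ 2) (sym (2d i)) (ℕₚ.*-monoʳ-≤ 2 d≤1)

  -- The theorem spells 2n - 2 in two ways, `2 * (n ∸ 1)` and `2 * n ∸ 2`, which do not agree by
  -- computation.
  top top′ : ℕ
  top  = 2 ℕ.* suc n
  top′ = 2 ℕ.* suc (suc n) ℕ.∸ 2

  top′≡top : top′ ≡ top
  top′≡top = cong (ℕ._∸ 2) (ℕₚ.*-suc 2 (suc n))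

  rowSum≤top : ∀ i → rowSum (signlessLaplacian D) i ℕ.≤ top
  rowSum≤top i = subst (ℕ._≤ top) (sym (2d i)) (ℕₚ.*-monoʳ-≤ 2 (ℕₚ.≤-pred (outdegree<n D i)))

  top′≤rowSum : ∀ i → suc (suc n) ℕ.≤ suc (outdegree D i) → top′ ℕ.≤ rowSum (signlessLaplacian D) i
  top′≤rowSum i n≤1+d = subst (ℕ._≤ rowSum (signlessLaplacian D) i) (sym top′≡top)
    (subst (top ℕ.≤_) (sym (2d i)) (ℕₚ.*-monoʳ-≤ 2 (ℕₚ.≤-pred n≤1+d)))

  full : ∀ i → fromℕ top′ ≤ q → suc (suc n) ℕ.≤ suc (outdegree D i)
  full i top≤q = ℕ.s≤s (ℕₚ.*-cancelˡ-≤ 2 (subst (top ℕ.≤_) (2d i)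
    (radius-≤-tight isRadius top rowSum≤top (subst (λ c → fromℕ c ≤ q) top′≡top top≤q) i)))

  single : ∀ i → q ≤ fromℕ 2 → outdegree D i ℕ.≤ 1
  single i q≤2 = ℕₚ.*-cancelˡ-≤ 2 (subst (ℕ._≤ 2) (2d i) (≤-radius-tight isRadius 2 2≤rowSum q≤2 i))

  cycle : (∀ i → outdegree D i ℕ.≤ 1) → D ≅ directedCycle (suc (suc n)) 2≤n
  cycle d≤1 = FunctionalDigraph.≅-directedCycle 2≤n D connected next arc-next
    (λ {i} e → outdegree≤1⇒unique D (d≤1 i) (arc-next i) e)
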